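{- Fix $n\in\mathbb Z_{\ge2}$ and $k\in\mathbb Z_{\ge1}$, and let $\searrow_n=n(n-1)\cdots1$. Then $$\dim P^{\mathrm{Av}(\searrow_n)}_k=|\mathrm{Av}_k(\searrow_n)|-|\mathrm{Av}_{k-1}(\searrow_n)|.$$
   Context: $\mathcal S_m$ is the set of permutations of $[m]$. For $I=\{i_1<\dots<i_m\}$, $\mathrm{pat}_I(\sigma)$ is the unique permutation with entries in the same relative order as $\sigma(i_1),\dots,\sigma(i_m)$. $\sigma$ avoids $\pi$ if no $I$ has $\mathrm{pat}_I(\sigma)=\pi$; $\mathrm{Av}_m(\searrow_n)$ is the set of size-$m$ permutations avoiding $\searrow_n$, with $\mathrm{Av}_0(\searrow_n)$ consisting of the empty permutation, and $\mathrm{Av}(\searrow_n)=\bigcup_{m\ge1}\mathrm{Av}_m(\searrow_n)$. For $\pi\in\mathcal S_k,\sigma\in\mathcal S_m$, $\widetilde{\mathrm{c\text{ - }occ}}(\pi,\sigma)$ is $1/m$ times the number of intervals $I=\{i,\dots,i+k-1\}$ with $\mathrm{pat}_I(\sigma)=\pi$. $P^{\mathrm{Av}(\searrow_n)}_k$ is the set of $\vec v\in[0,1]^{\mathcal S_k}$ for which there is a sequence $(\sigma^m)$ in $\mathrm{Av}(\searrow_n)$ with $|\sigma^m|\to\infty$ and $\widetilde{\mathrm{c\text{ - }occ}}(\pi,\sigma^m)\to\vec v_\pi$ for all $\pi\in\mathcal S_k$. This set is convex; its dimension is the dimension of its affine hull. -}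

module Defs where

open import Algebra.Bundles.Raw using (RawMonoid)
import Algebra.Definitions.RawMonoid as RawMonoidDefs
open import Data.Empty using (⊥-elim)
open import Data.Fin.Base as Fin using (Fin; toℕ; fromℕ<; opposite)
import Data.Fin.Properties as Fin
open import Data.Integer.Base using (+_)
open import Data.List.Base as List using (List; []; _∷_; [_]; length; filter; mapMaybe; cartesianProductWith)
open import Data.List.Membership.Propositional using (_∈_)
import Data.List.Membership.Propositional.Properties as List
open import Data.List.Relation.Unary.All as All using (All; []; _∷_)
open import Data.List.Relation.Unary.AllPairs as ListPairs using ([]; _∷_)
open import Data.List.Relation.Unary.Any using (here; there)
import Data.List.Relation.Unary.Unique.Propositional as List
import Data.List.Relation.Unary.Unique.Propositional.Properties as ListUnique
open import Data.Maybe.Base using (Maybe; just; nothing)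
open import Data.Nat.Base as ℕ using (ℕ; zero; suc; NonZero)
import Data.Nat.Properties as ℕ
open import Data.Product.Base using (Σ; ∃; ∃-syntax; _×_; _,_; proj₁; proj₂)
open import Data.Rational.Base as ℚ using (ℚ; 0ℚ; 1ℚ)
import Data.Rational.Properties as ℚ
open import Data.Rational.Solver using (module +-*-Solver)
open import Data.Sum.Base using (inj₁; inj₂)
open import Data.Vec.Base as Vec using (Vec; []; _∷_; lookup; tabulate)
import Data.Vec.Properties as Vec
import Data.Vec.Relation.Unary.AllPairs as Pairs
open import Data.Vec.Relation.Unary.Unique.Propositional using (Unique)
import Data.Vec.Relation.Unary.Unique.Propositional.Properties as Unique
open import Function.Base using (_∘_)
open import Function.Bundles using (_⇔_; mk⇔; Equivalence)
open import Level using (0ℓ)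
open import Relation.Binary.PropositionalEquality
  using (_≡_; _≢_; refl; sym; trans; cong; subst; subst₂)
open import Relation.Nullary using (Dec; yes; no; ¬_; contradiction)
open import Relation.Nullary.Decidable using (map′; ¬?; _×-dec_; _→-dec_; recompute)
open import Relation.Unary using (Pred; Decidable)

-- Cauchy sequences of rationals (with modulus), to be compared with _≈ℝ_.
record ℝ : Set where
  constructor mkℝ
  field
    seq    : ℕ → ℚ
    cauchy : ∀ ε → 0ℚ ℚ.< ε →
             ∃[ N ] ∀ i j → N ℕ.≤ i → N ℕ.≤ j → ℚ.∣ seq i ℚ.- seq j ∣ ℚ.≤ ε

open ℝ public

infix  4 _≈ℝ_ _≤ℝ_
infixl 6 _+ℝ_ _-ℝ_
infixl 7 _*ℝ_
infix  8 -ℝ_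

_≈ℝ_ : ℝ → ℝ → Set
x ≈ℝ y = ∀ ε → 0ℚ ℚ.< ε → ∃[ N ] ∀ i → N ℕ.≤ i → ℚ.∣ seq x i ℚ.- seq y i ∣ ℚ.≤ ε

_≤ℝ_ : ℝ → ℝ → Set
x ≤ℝ y = ∀ ε → 0ℚ ℚ.< ε → ∃[ N ] ∀ i → N ℕ.≤ i → seq x i ℚ.≤ seq y i ℚ.+ ε

fromℚ : ℚ → ℝ
fromℚ q = mkℝ (λ _ → q) λ ε 0<ε → 0 , λ _ _ _ _ →
  subst (λ z → ℚ.∣ z ∣ ℚ.≤ ε) (sym (ℚ.+-inverseʳ q)) (ℚ.<⇒≤ 0<ε)

0ℝ 1ℝ : ℝ
0ℝ = fromℚ 0ℚ
1ℝ = fromℚ 1ℚ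

private

  half : ℚ → ℚ
  half ε = ε ℚ.* ℚ.½

  half-pos : ∀ {ε} → 0ℚ ℚ.< ε → 0ℚ ℚ.< half ε
  half-pos {ε} 0<ε = subst (ℚ._< half ε) (ℚ.*-zeroˡ ℚ.½) (ℚ.*-monoˡ-<-pos ℚ.½ 0<ε)

  half+half : ∀ ε → half ε ℚ.+ half ε ≡ ε
  half+half ε = trans (sym (ℚ.*-distribˡ-+ ε ℚ.½ ℚ.½)) (ℚ.*-identityʳ ε)

  +-rearrange : ∀ a b c d → (a ℚ.+ b) ℚ.- (c ℚ.+ d) ≡ (a ℚ.- c) ℚ.+ (b ℚ.- d)
  +-rearrange = solve 4 (λ a b c d → (a :+ b) :- (c :+ d) := (a :- c) :+ (b :- d)) refl
    where open +-*-Solver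

  neg-rearrange : ∀ a b → (ℚ.- a) ℚ.- (ℚ.- b) ≡ ℚ.- (a ℚ.- b)
  neg-rearrange = solve 2 (λ a b → (:- a) :- (:- b) := :- (a :- b)) refl
    where open +-*-Solver

  *-rearrange : ∀ a b c d →
    (a ℚ.* b) ℚ.- (c ℚ.* d) ≡ a ℚ.* (b ℚ.- d) ℚ.+ d ℚ.* (a ℚ.- c)
  *-rearrange = solve 4 (λ a b c d →
    (a :* b) :- (c :* d) := a :* (b :- d) :+ d :* (a :- c)) refl
    where open +-*-Solver

  cancel-sub : ∀ a b → (a ℚ.- b) ℚ.+ b ≡ a
  cancel-sub = solve 2 (λ a b → (a :- b) :+ b := a) refl
    where open +-*-Solver

  cancel-add : ∀ a b → (a ℚ.+ b) ℚ.- b ≡ a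
  cancel-add = solve 2 (λ a b → (a :+ b) :- b := a) refl
    where open +-*-Solver

  flip-sub : ∀ a b → ℚ.- (a ℚ.- b) ≡ b ℚ.- a
  flip-sub = solve 2 (λ a b → :- (a :- b) := b :- a) refl
    where open +-*-Solver

  ∣∣-≤ : ∀ a b → ℚ.∣ a ∣ ℚ.≤ ℚ.∣ a ℚ.- b ∣ ℚ.+ ℚ.∣ b ∣
  ∣∣-≤ a b = subst (λ z → ℚ.∣ z ∣ ℚ.≤ ℚ.∣ a ℚ.- b ∣ ℚ.+ ℚ.∣ b ∣)
    (cancel-sub a b) (ℚ.∣p+q∣≤∣p∣+∣q∣ (a ℚ.- b) b)

  ∣∣-sub-≤ : ∀ a b → ℚ.∣ a ∣ ℚ.- ℚ.∣ b ∣ ℚ.≤ ℚ.∣ a ℚ.- b ∣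
  ∣∣-sub-≤ a b = subst (ℚ.∣ a ∣ ℚ.- ℚ.∣ b ∣ ℚ.≤_)
    (cancel-add ℚ.∣ a ℚ.- b ∣ ℚ.∣ b ∣) (ℚ.+-monoˡ-≤ (ℚ.- ℚ.∣ b ∣) (∣∣-≤ a b))

  ∣∣-rev-triangle : ∀ a b → ℚ.∣ ℚ.∣ a ∣ ℚ.- ℚ.∣ b ∣ ∣ ℚ.≤ ℚ.∣ a ℚ.- b ∣
  ∣∣-rev-triangle a b with ℚ.∣p∣≡p∨∣p∣≡-p (ℚ.∣ a ∣ ℚ.- ℚ.∣ b ∣)
  ... | inj₁ eq = subst (ℚ._≤ ℚ.∣ a ℚ.- b ∣) (sym eq) (∣∣-sub-≤ a b)
  ... | inj₂ eq = subst₂ ℚ._≤_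
      (sym (trans eq (flip-sub ℚ.∣ a ∣ ℚ.∣ b ∣)))
      (trans (sym (ℚ.∣-p∣≡∣p∣ (b ℚ.- a))) (cong ℚ.∣_∣ (flip-sub b a)))
      (∣∣-sub-≤ b a)

  -- Every Cauchy sequence is eventually bounded by a positive rational.
  bounded : ∀ x → ∃[ B ] 0ℚ ℚ.< B × ∃[ N ] ∀ i → N ℕ.≤ i → ℚ.∣ seq x i ∣ ℚ.≤ B
  bounded x with cauchy x 1ℚ (ℚ.positive⁻¹ 1ℚ)
  ... | N , close = 1ℚ ℚ.+ ℚ.∣ seq x N ∣
    , ℚ.<-≤-trans (ℚ.positive⁻¹ 1ℚ)
        (subst (ℚ._≤ 1ℚ ℚ.+ ℚ.∣ seq x N ∣) (ℚ.+-identityʳ 1ℚ)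
          (ℚ.+-monoʳ-≤ 1ℚ (ℚ.0≤∣p∣ (seq x N))))
    , N
    , λ i N≤i → ℚ.≤-trans (∣∣-≤ (seq x i) (seq x N))
        (ℚ.+-monoˡ-≤ ℚ.∣ seq x N ∣ (close i N N≤i ℕ.≤-refl))

  *-≤ : ∀ {a b c d} → ℚ.∣ a ∣ ℚ.≤ c → ℚ.∣ b ∣ ℚ.≤ d → ℚ.∣ a ℚ.* b ∣ ℚ.≤ c ℚ.* d
  *-≤ {a} {b} {c} {d} a≤c b≤d = subst (ℚ._≤ c ℚ.* d) (sym (ℚ.∣p*q∣≡∣p∣*∣q∣ a b))
    (ℚ.≤-trans
      (ℚ.*-monoʳ-≤-nonNeg ℚ.∣ b ∣ {{ℚ.nonNegative (ℚ.0≤∣p∣ b)}} a≤c)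
      (ℚ.*-monoˡ-≤-nonNeg c {{ℚ.nonNegative (ℚ.≤-trans (ℚ.0≤∣p∣ a) a≤c)}} b≤d))

_+ℝ_ : ℝ → ℝ → ℝ
x +ℝ y = mkℝ (λ i → seq x i ℚ.+ seq y i) λ ε 0<ε →
  let (M , p) = cauchy x (half ε) (half-pos 0<ε)
      (N , q) = cauchy y (half ε) (half-pos 0<ε)
  in M ℕ.⊔ N , λ i j ≤i ≤j →
    subst₂ (λ l r → ℚ.∣ l ∣ ℚ.≤ r)
      (sym (+-rearrange (seq x i) (seq y i) (seq x j) (seq y j)))
      (half+half ε)
      (ℚ.≤-trans (ℚ.∣p+q∣≤∣p∣+∣q∣ (seq x i ℚ.- seq x j) (seq y i ℚ.- seq y j))
        (ℚ.+-mono-≤ (p i j (ℕ.m⊔n≤o⇒m≤o M N ≤i) (ℕ.m⊔n≤o⇒m≤o M N ≤j))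
                    (q i j (ℕ.m⊔n≤o⇒n≤o M N ≤i) (ℕ.m⊔n≤o⇒n≤o M N ≤j))))

-ℝ_ : ℝ → ℝ
-ℝ x = mkℝ (λ i → ℚ.- seq x i) λ ε 0<ε →
  let (N , p) = cauchy x ε 0<ε
  in N , λ i j ≤i ≤j →
    subst (ℚ._≤ ε)
      (sym (trans (cong ℚ.∣_∣ (neg-rearrange (seq x i) (seq x j)))
                  (ℚ.∣-p∣≡∣p∣ (seq x i ℚ.- seq x j))))
      (p i j ≤i ≤j)

_-ℝ_ : ℝ → ℝ → ℝ
x -ℝ y = x +ℝ (-ℝ y)

∣_∣ℝ : ℝ → ℝ
∣ x ∣ℝ = mkℝ (λ i → ℚ.∣ seq x i ∣) λ ε 0<ε →
  let (N , p) = cauchy x ε 0<ε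
  in N , λ i j ≤i ≤j → ℚ.≤-trans (∣∣-rev-triangle (seq x i) (seq x j)) (p i j ≤i ≤j)

_*ℝ_ : ℝ → ℝ → ℝ
x *ℝ y = mkℝ (λ i → seq x i ℚ.* seq y i) λ ε 0<ε →
  let (B , 0<B , K , x≤B) = bounded x
      (C , 0<C , L , y≤C) = bounded y
      D = B ℚ.+ C
      0<D : 0ℚ ℚ.< D
      0<D = ℚ.+-mono-< 0<B 0<C
      instance
        D-pos : ℚ.Positive D
        D-pos = ℚ.positive 0<D
        D-nonZero : ℚ.NonZero D
        D-nonZero = ℚ.pos⇒nonZero D
      δ = ε ℚ.* ℚ.1/ D
      0<δ : 0ℚ ℚ.< δ
      0<δ = subst (ℚ._< δ) (ℚ.*-zeroˡ (ℚ.1/ D))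
        (ℚ.*-monoˡ-<-pos (ℚ.1/ D) {{ℚ.1/pos⇒pos D}} 0<ε)
      (M , p) = cauchy x δ 0<δ
      (N , q) = cauchy y δ 0<δ
      Dδ≡ε : B ℚ.* δ ℚ.+ C ℚ.* δ ≡ ε
      Dδ≡ε = trans (sym (ℚ.*-distribʳ-+ δ B C))
        (trans (ℚ.*-comm D δ)
        (trans (ℚ.*-assoc ε (ℚ.1/ D) D)
        (trans (cong (ε ℚ.*_) (ℚ.*-inverseˡ D)) (ℚ.*-identityʳ ε))))
  in (K ℕ.⊔ L) ℕ.⊔ (M ℕ.⊔ N) , λ i j ≤i ≤j →
    let KL≤i = ℕ.m⊔n≤o⇒m≤o (K ℕ.⊔ L) (M ℕ.⊔ N) ≤i
        MN≤i = ℕ.m⊔n≤o⇒n≤o (K ℕ.⊔ L) (M ℕ.⊔ N) ≤i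
        KL≤j = ℕ.m⊔n≤o⇒m≤o (K ℕ.⊔ L) (M ℕ.⊔ N) ≤j
        MN≤j = ℕ.m⊔n≤o⇒n≤o (K ℕ.⊔ L) (M ℕ.⊔ N) ≤j
        dx = p i j (ℕ.m⊔n≤o⇒m≤o M N MN≤i) (ℕ.m⊔n≤o⇒m≤o M N MN≤j)
        dy = q i j (ℕ.m⊔n≤o⇒n≤o M N MN≤i) (ℕ.m⊔n≤o⇒n≤o M N MN≤j)
    in subst₂ (λ l r → ℚ.∣ l ∣ ℚ.≤ r)
      (sym (*-rearrange (seq x i) (seq y i) (seq x j) (seq y j)))
      Dδ≡ε
      (ℚ.≤-trans
        (ℚ.∣p+q∣≤∣p∣+∣q∣ (seq x i ℚ.* (seq y i ℚ.- seq y j)) (seq y j ℚ.* (seq x i ℚ.- seq x j)))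
        (ℚ.+-mono-≤
          (*-≤ {seq x i} {seq y i ℚ.- seq y j} (x≤B i (ℕ.m⊔n≤o⇒m≤o K L KL≤i)) dy)
          (*-≤ {seq y j} {seq x i ℚ.- seq x j} (y≤C j (ℕ.m⊔n≤o⇒n≤o K L KL≤j)) dx)))

+ℝ-rawMonoid : RawMonoid 0ℓ 0ℓ
+ℝ-rawMonoid = record { Carrier = ℝ ; _≈_ = _≈ℝ_ ; _∙_ = _+ℝ_ ; ε = 0ℝ }

open RawMonoidDefs +ℝ-rawMonoid public using () renaming (sum to sumℝ)

_⟶_ : (ℕ → ℝ) → ℝ → Set
s ⟶ l = ∀ ε → 0ℚ ℚ.< ε → ∃[ N ] ∀ i → N ℕ.≤ i → ∣ s i -ℝ l ∣ℝ ≤ℝ fromℚ ε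

_⟶∞ : (ℕ → ℕ) → Set
s ⟶∞ = ∀ B → ∃[ N ] ∀ i → N ℕ.≤ i → B ℕ.≤ s i

-- One-line notation, with values and positions shifted down to
-- {0,…,m-1}.  Unlike for Data.Fin.Permutation, propositional equality of
-- these is equality of permutations, so that Perm k → ℝ is ℝ^(S_k).
record Perm (m : ℕ) : Set where
  constructor mkPerm
  field
    word      : Vec (Fin m) m
    .distinct : Unique word

open Perm public

infixl 9 _at_

_at_ : ∀ {m} → Perm m → Fin m → Fin m
σ at i = lookup (word σ) i

↘ : ∀ n → Perm n
↘ n = mkPerm (tabulate opposite) (Unique.tabulate⁺ opposite-injective)
  where
  opposite-injective : ∀ {i j : Fin n} → opposite i ≡ opposite j → i ≡ j
  opposite-injective {i} {j} eq = trans (sym (Fin.opposite-involutive i))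
    (trans (cong opposite eq) (Fin.opposite-involutive j))

-- A k-element subset {i₁ < ⋯ < i_k} of the positions is the vector
-- (i₁,…,i_k).
Increasing : ∀ {m k} → Vec (Fin m) k → Set
Increasing I = ∀ a b → a Fin.< b → lookup I a Fin.< lookup I b

increasing? : ∀ {m k} (I : Vec (Fin m) k) → Dec (Increasing I)
increasing? I = Fin.all? λ a → Fin.all? λ b →
  (a Fin.<? b) →-dec (lookup I a Fin.<? lookup I b)

-- pat_I(σ) = π: the entries of π are in the same relative order as
-- σ(i₁),…,σ(i_k), which determines π.
Pat : ∀ {m k} → Vec (Fin m) k → Perm m → Perm k → Set
Pat I σ π = ∀ a b → (π at a Fin.< π at b) ⇔ (σ at lookup I a Fin.< σ at lookup I b)

pat? : ∀ {m k} (I : Vec (Fin m) k) (σ : Perm m) (π : Perm k) → Dec (Pat I σ π)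
pat? I σ π = Fin.all? λ a → Fin.all? λ b →
  let P? = π at a Fin.<? π at b
      Q? = σ at lookup I a Fin.<? σ at lookup I b
  in map′ (λ (f , g) → mk⇔ f g) (λ e → Equivalence.to e , Equivalence.from e)
       ((P? →-dec Q?) ×-dec (Q? →-dec P?))

_avoids_ : ∀ {m k} → Perm m → Perm k → Set
_avoids_ {m} {k} σ π = ¬ (∃[ I ] Increasing {m} {k} I × Pat I σ π)

private
  anyVec? : ∀ {m} k {P : Pred (Vec (Fin m) k) 0ℓ} → Decidable P → Dec (∃ P)
  anyVec? zero    P? = map′ ([] ,_) (λ { ([] , p) → p }) (P? [])
  anyVec? (suc k) P? = map′ (λ (i , I , p) → i ∷ I , p) (λ { (i ∷ I , p) → i , I , p })
    (Fin.any? λ i → anyVec? k λ I → P? (i ∷ I))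

_avoids?_ : ∀ {m k} (σ : Perm m) (π : Perm k) → Dec (σ avoids π)
_avoids?_ {k = k} σ π = ¬? (anyVec? k λ I → increasing? I ×-dec pat? I σ π)

unique? : ∀ {m k} (w : Vec (Fin m) k) → Dec (Unique w)
unique? = Pairs.allPairs? λ x y → ¬? (x Fin.≟ y)

allWords : ∀ m k → List (Vec (Fin m) k)
allWords m zero    = [ [] ]
allWords m (suc k) = cartesianProductWith _∷_ (List.allFin m) (allWords m k)

toPerm : ∀ {m} → Vec (Fin m) m → Maybe (Perm m)
toPerm w with unique? w
... | yes u = just (mkPerm w u)
... | no  _ = nothing

-- Lists every permutation exactly once: see allPerms-complete and
-- allPerms-unique below.
allPerms : ∀ m → List (Perm m)
allPerms m = mapMaybe toPerm (allWords m m)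

∣Av∣ : (m n : ℕ) → ℕ
∣Av∣ m n = length (filter (_avoids? ↘ n) (allPerms m))

private
  allWords-complete : ∀ {m} k (w : Vec (Fin m) k) → w ∈ allWords m k
  allWords-complete zero    []      = here refl
  allWords-complete (suc k) (x ∷ w) =
    List.∈-cartesianProductWith⁺ _∷_ (List.∈-allFin x) (allWords-complete k w)

  allWords-unique : ∀ m k → List.Unique (allWords m k)
  allWords-unique m zero    = [] ∷ []
  allWords-unique m (suc k) = ListUnique.cartesianProductWith⁺ _∷_ Vec.∷-injective
    (ListUnique.allFin⁺ m) (allWords-unique m k)

  toPerm-word : ∀ {m} (σ : Perm m) → toPerm (word σ) ≡ just σ
  toPerm-word (mkPerm w u) with unique? w
  ... | yes _  = refl
  ... | no ¬u = contradiction (recompute (unique? w) u) ¬u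

  word-toPerm : ∀ {m} (w : Vec (Fin m) m) {σ} → toPerm w ≡ just σ → word σ ≡ w
  word-toPerm w eq with unique? w
  word-toPerm w refl | yes _ = refl

  mapMaybe-complete : ∀ {m} (σ : Perm m) ws → word σ ∈ ws → σ ∈ mapMaybe toPerm ws
  mapMaybe-complete σ (w ∷ ws) (here refl) rewrite toPerm-word σ = here refl
  mapMaybe-complete σ (w ∷ ws) (there ∈ws) with toPerm w
  ... | just _  = there (mapMaybe-complete σ ws ∈ws)
  ... | nothing = mapMaybe-complete σ ws ∈ws

  mapMaybe-fresh : ∀ {m} (σ : Perm m) ws → All (word σ ≢_) ws → All (σ ≢_) (mapMaybe toPerm ws)
  mapMaybe-fresh σ []       []         = []
  mapMaybe-fresh σ (w ∷ ws) (≢w ∷ ≢ws) with toPerm w in eq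
  ... | just τ  = (λ { refl → ≢w (word-toPerm w eq) }) ∷ mapMaybe-fresh σ ws ≢ws
  ... | nothing = mapMaybe-fresh σ ws ≢ws

  mapMaybe-unique : ∀ {m} (ws : List (Vec (Fin m) m)) → List.Unique ws → List.Unique (mapMaybe toPerm ws)
  mapMaybe-unique []       []         = []
  mapMaybe-unique (w ∷ ws) (fr ∷ uq) with toPerm w in eq
  ... | just τ  = mapMaybe-fresh τ ws (subst (λ v → All (v ≢_) ws) (sym (word-toPerm w eq)) fr)
                  ∷ mapMaybe-unique ws uq
  ... | nothing = mapMaybe-unique ws uq

allPerms-complete : ∀ {m} (σ : Perm m) → σ ∈ allPerms m
allPerms-complete {m} σ = mapMaybe-complete σ (allWords m m) (allWords-complete m (word σ))

allPerms-unique : ∀ m → List.Unique (allPerms m)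
allPerms-unique m = mapMaybe-unique (allWords m m) (allWords-unique m m)

interval : ∀ {m} k (i : Fin m) → .(toℕ i ℕ.+ k ℕ.≤ m) → Vec (Fin m) k
interval k i i+k≤m = tabulate λ a →
  fromℕ< (ℕ.≤-trans (ℕ.+-monoʳ-< (toℕ i) (Fin.toℕ<n a)) i+k≤m)

OccursAt : ∀ {m k} → Perm k → Perm m → Fin m → Set
OccursAt {m} {k} π σ i = Σ (toℕ i ℕ.+ k ℕ.≤ m) λ i+k≤m → Pat (interval k i i+k≤m) σ π

occursAt? : ∀ {m k} (π : Perm k) (σ : Perm m) → Decidable (OccursAt π σ)
occursAt? {m} {k} π σ i with toℕ i ℕ.+ k ℕ.≤? m
... | no  i+k≰m = no (i+k≰m ∘ proj₁)
... | yes i+k≤m = map′ (i+k≤m ,_) proj₂ (pat? (interval k i i+k≤m) σ π)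

-- For k ≥ 1, distinct starting points give distinct intervals.
c-occ : ∀ {m k} → Perm k → Perm m → ℕ
c-occ {m} π σ = length (filter (occursAt? π σ) (List.allFin m))

c-occ~ : ∀ {m k} .{{_ : NonZero m}} → Perm k → Perm m → ℚ
c-occ~ {m} π σ = + c-occ π σ ℚ./ m

-- The elements of Av(↘ n), which are nonempty permutations.
record AvPerm (n : ℕ) : Set where
  field
    size         : ℕ
    {{nonEmpty}} : NonZero size
    perm         : Perm size
    avoiding     : perm avoids ↘ n

open AvPerm public

Point : ℕ → Set
Point k = Perm k → ℝ

FeasibleRegion : (n k : ℕ) → Pred (Point k) 0ℓ
FeasibleRegion n k v =
  (∀ π → 0ℝ ≤ℝ v π × v π ≤ℝ 1ℝ) ×
  Σ (ℕ → AvPerm n) λ σ →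
    (λ i → size (σ i)) ⟶∞ ×
    (∀ π → (λ i → fromℚ (c-occ~ {{nonEmpty (σ i)}} π (perm (σ i)))) ⟶ v π)

infix 4 _≈ₚ_

_≈ₚ_ : ∀ {k} → Point k → Point k → Set
x ≈ₚ y = ∀ π → x π ≈ℝ y π

linComb : ∀ {k r} → (Fin r → ℝ) → (Fin r → Point k) → Point k
linComb c p π = sumℝ λ i → c i *ℝ p i π

AffineHull : ∀ {k} → Pred (Point k) 0ℓ → Pred (Point k) 0ℓ
AffineHull {k} A x = ∃[ r ] Σ (Fin r → Point k) λ p → Σ (Fin r → ℝ) λ c →
  (∀ i → A (p i)) × sumℝ c ≈ℝ 1ℝ × x ≈ₚ linComb c p

LinearlyIndependent : ∀ {k r} → (Fin r → Point k) → Set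
LinearlyIndependent e = ∀ c → linComb c e ≈ₚ (λ _ → 0ℝ) → ∀ i → c i ≈ℝ 0ℝ

-- A is a translate of a d-dimensional linear subspace.
IsAffineOfDim : ∀ {k} → Pred (Point k) 0ℓ → ℕ → Set
IsAffineOfDim {k} A d = Σ (Point k) λ p → Σ (Fin d → Point k) λ e →
  LinearlyIndependent e ×
  (∀ x → A x ⇔ (∃[ c ] x ≈ₚ (λ π → p π +ℝ linComb c e π)))

HasDimension : ∀ {k} → Pred (Point k) 0ℓ → ℕ → Set
HasDimension A d = IsAffineOfDim (AffineHull A) d

{-# OPTIONS --safe #-}

-- Write k = K + 1 and call beg π, end π the patterns of the first and last K
-- entries of π.  A window of an avoiding permutation avoids too, and
-- consecutive windows w, w′ satisfy end w = beg w′, so feasible points are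
-- flows of total mass 1 in the overlap graph with vertices Av_K and edges
-- π : beg π → end π for π in Av_k.  The edges ρ ⊕ 1, of which there is one for
-- each vertex ρ, lead every vertex to the identity; apart from the loop at
-- the identity they form a spanning tree.  Hence with
--   E π = [π] - [id] + path (end π) - path (beg π),
-- where path ρ sums the windows of ρ ⊕ 1 ⊕ 1 ⊕ ⋯ starting in ρ, every flow v
-- of mass 1 is [id] + Σ v_π E π.  Here E π = 0 for the tree edges π, and at
-- the other edges τ the coordinate of E π is [π = τ], so that the non-tree
-- edges give an independent family, of size |Av_k| - |Av_K|.  Conversely
-- E π lies in the direction of the affine hull, because it is a multiple of
-- the difference of the frequency vectors of the periodic permutations
-- (id_k ⊕ π) ⊕ (id_k ⊕ π) ⊕ ⋯ and (id_k ⊕ π′) ⊕ (id_k ⊕ π′) ⊕ ⋯, where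
-- π′ = beg π ⊕ 1; these avoid n⋯1 as n ≥ 2.
module Submission where

open import Defs
open import Algebra.Bundles using (CommutativeRing)
import Algebra.Properties.Semiring.Sum as SemiringSum
open import Data.Fin.Base as Fin using (Fin; zero; suc; toℕ; fromℕ<; opposite; punchOut)
import Data.Fin.Properties as Fin
import Data.Integer.Base as ℤ
import Data.Integer.Properties as ℤ
import Data.Integer.Solver as ℤ
open import Data.List.Base as List using (List; []; _∷_; length; filter)
open import Data.List.Membership.Propositional using (_∈_)
open import Data.List.Membership.Propositional.Properties using (∈-filter⁺; ∈-filter⁻; ∈-map⁺; ∈-map⁻; ∈-lookup)
open import Data.List.Membership.Propositional.Properties.WithK using (unique∧set⇒bag)
import Data.List.Properties as List
open import Data.List.Relation.Binary.BagAndSetEquality using (∼bag⇒↭)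
open import Data.List.Relation.Binary.Permutation.Propositional.Properties using (↭-length)
import Data.List.Relation.Unary.All as All
open import Data.List.Relation.Unary.AllPairs using (_∷_)
open import Data.List.Relation.Unary.Any using (index)
open import Data.List.Relation.Unary.Any.Properties using (lookup-index)
import Data.List.Relation.Unary.Unique.Propositional as List
import Data.List.Relation.Unary.Unique.Propositional.Properties as ListUnique
open import Data.Nat.Base
open import Data.Nat.DivMod
open import Data.Nat.Divisibility using (n∣m*n; ∣-refl)
open import Data.Nat.Properties
open import Data.Product.Base using (Σ; ∃-syntax; _×_; _,_; proj₁; proj₂)
open import Data.Rational.Base as ℚ using (ℚ; 0ℚ; 1ℚ; mkℚ)
import Data.Rational.Properties as ℚ
open import Data.Rational.Solver using (module +-*-Solver)
import Data.Rational.Unnormalised.Base as ℚᵘ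
import Data.Rational.Unnormalised.Properties as ℚᵘ
open import Data.Sum.Base using (inj₁; inj₂)
open import Data.Vec.Base using (lookup; tabulate)
import Data.Vec.Properties as Vec
import Data.Vec.Relation.Unary.Unique.Propositional.Properties as VecUnique
open import Function.Base using (_∘_; id)
open import Function.Bundles using (_⇔_; mk⇔; Equivalence)
open import Level using (0ℓ)
open import Relation.Binary.Definitions using (tri<; tri≈; tri>)
open import Relation.Binary.PropositionalEquality
open import Relation.Nullary using (Dec; yes; no; ¬_; contradiction)
open import Relation.Nullary.Decidable using (recompute; map′; ¬?; _×-dec_)
open import Relation.Unary using (Pred; Decidable)

-- Finite sums and indicators

ι : ∀ {P : Set} → Dec P → ℕ
ι (yes _) = 1
ι (no _)  = 0

ι-yes : ∀ {P : Set} (P? : Dec P) → P → ι P? ≡ 1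
ι-yes (yes _) _ = refl
ι-yes (no ¬p) p = contradiction p ¬p

ι-no : ∀ {P : Set} (P? : Dec P) → ¬ P → ι P? ≡ 0
ι-no (yes p) ¬p = contradiction p ¬p
ι-no (no _)  _  = refl

ι-cong : ∀ {P Q : Set} (P? : Dec P) (Q? : Dec Q) → (P → Q) → (Q → P) → ι P? ≡ ι Q?
ι-cong (yes p) Q? f g = sym (ι-yes Q? (f p))
ι-cong (no ¬p) Q? f g = sym (ι-no Q? (¬p ∘ g))

ι≤1 : ∀ {P : Set} (P? : Dec P) → ι P? ≤ 1
ι≤1 (yes _) = ≤-refl
ι≤1 (no _)  = z≤n

∑< : ℕ → (ℕ → ℕ) → ℕ
∑< zero    f = 0
∑< (suc n) f = ∑< n f + f n

∑<-cong : ∀ n {f g : ℕ → ℕ} → (∀ i → i < n → f i ≡ g i) → ∑< n f ≡ ∑< n g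
∑<-cong zero    eq = refl
∑<-cong (suc n) eq = cong₂ _+_ (∑<-cong n λ i i<n → eq i (m<n⇒m<1+n i<n)) (eq n (n<1+n n))

∑<-mono-≤ : ∀ n {f g : ℕ → ℕ} → (∀ i → i < n → f i ≤ g i) → ∑< n f ≤ ∑< n g
∑<-mono-≤ zero    le = z≤n
∑<-mono-≤ (suc n) le = +-mono-≤ (∑<-mono-≤ n λ i i<n → le i (m<n⇒m<1+n i<n)) (le n (n<1+n n))

∑<-mono-< : ∀ n {f g : ℕ → ℕ} → (∀ i → i < n → f i ≤ g i) →
            ∀ {c} → c < n → f c < g c → ∑< n f < ∑< n g
∑<-mono-< (suc n) le {c} c<1+n lt with m≤n⇒m<n∨m≡n (s≤s⁻¹ c<1+n)
... | inj₁ c<n  = +-mono-<-≤ (∑<-mono-< n (λ i i<n → le i (m<n⇒m<1+n i<n)) c<n lt) (le n (n<1+n n))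
... | inj₂ refl = +-mono-≤-< (∑<-mono-≤ n λ i i<n → le i (m<n⇒m<1+n i<n)) lt

∑<-const : ∀ n c → ∑< n (λ _ → c) ≡ n * c
∑<-const zero    c = refl
∑<-const (suc n) c = trans (+-comm _ c) (cong (c +_) (∑<-const n c))

∑<-zero : ∀ n {f : ℕ → ℕ} → (∀ i → i < n → f i ≡ 0) → ∑< n f ≡ 0
∑<-zero n eq = trans (∑<-cong n eq) (trans (∑<-const n 0) (*-zeroʳ n))

∑<-distrib-+ : ∀ n (f g : ℕ → ℕ) → ∑< n (λ i → f i + g i) ≡ ∑< n f + ∑< n g
∑<-distrib-+ zero    f g = refl
∑<-distrib-+ (suc n) f g = trans (cong (_+ (f n + g n)) (∑<-distrib-+ n f g))
  (trans (+-assoc (∑< n f) (∑< n g) _)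
  (trans (cong (∑< n f +_) (trans (sym (+-assoc (∑< n g) (f n) (g n)))
     (trans (cong (_+ g n) (+-comm (∑< n g) (f n))) (+-assoc (f n) _ (g n)))))
  (sym (+-assoc (∑< n f) (f n) _))))

∑<-split : ∀ m n (f : ℕ → ℕ) → ∑< (m + n) f ≡ ∑< m f + ∑< n (λ i → f (m + i))
∑<-split m zero    f = trans (cong (λ l → ∑< l f) (+-identityʳ m)) (sym (+-identityʳ _))
∑<-split m (suc n) f = trans (cong (λ l → ∑< l f) (+-suc m n))
  (trans (cong (_+ f (m + n)) (∑<-split m n f)) (+-assoc (∑< m f) _ _))

∑<-head : ∀ n (f : ℕ → ℕ) → ∑< (suc n) f ≡ f 0 + ∑< n (f ∘ suc)
∑<-head n f = ∑<-split 1 n f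

∑<-truncate : ∀ {M m} → M ≤ m → (f g : ℕ → ℕ) → (∀ i → i < M → f i ≡ g i) →
              (∀ i → M ≤ i → i < m → f i ≡ 0) → ∑< m f ≡ ∑< M g
∑<-truncate {M} {m} M≤m f g eq zr = trans (cong (λ l → ∑< l f) (sym (m+[n∸m]≡n M≤m)))
  (trans (∑<-split M (m ∸ M) f)
  (trans (cong₂ _+_ (∑<-cong M eq)
    (∑<-zero (m ∸ M) λ i i<m∸M → zr (M + i) (m≤m+n M i)
      (subst (M + i <_) (m+[n∸m]≡n M≤m) (+-monoʳ-< M i<m∸M))))
  (+-identityʳ _)))

∑<-unique : ∀ n (f : ℕ → ℕ) {c} → c < n → (∀ i → i < n → i ≢ c → f i ≡ 0) → ∑< n f ≡ f c
∑<-unique (suc n) f {c} c<1+n zr with m≤n⇒m<n∨m≡n (s≤s⁻¹ c<1+n)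
... | inj₁ c<n  = trans (cong₂ _+_
  (∑<-unique n f c<n λ i i<n → zr i (m<n⇒m<1+n i<n))
  (zr n (n<1+n n) λ n≡c → <-irrefl (sym n≡c) c<n)) (+-identityʳ _)
... | inj₂ refl = cong (_+ f n) (∑<-zero n λ i i<n → zr i (m<n⇒m<1+n i<n) (<⇒≢ i<n))

∑<-periodic : ∀ P (f : ℕ → ℕ) → (∀ i → f (P + i) ≡ f i) → ∀ N → ∑< (N * P) f ≡ N * ∑< P f
∑<-periodic P f per zero    = refl
∑<-periodic P f per (suc N) = trans (∑<-split P (N * P) f)
  (cong (∑< P f +_) (trans (∑<-cong (N * P) λ i _ → per i) (∑<-periodic P f per N)))

-- Injective sequences up to order isomorphism

-- Permutations are handled as prefixes of infinite sequences of which only the relative order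
-- matters. Windows then become shifts, which need no bounds on positions.
record Seq : Set where
  constructor mkSeq
  field
    val : ℕ → ℕ
    inj : ∀ {a b} → val a ≡ val b → a ≡ b

open Seq public

shift : ℕ → Seq → Seq
shift i s = mkSeq (λ a → val s (i + a)) λ eq → +-cancelˡ-≡ i _ _ (inj s eq)

idSeq : Seq
idSeq = mkSeq id id

infix 4 _~[_]_

-- By injectivity of the sequences this is symmetric: it says that they
-- have the same relative order on {0,…,l-1}.
_~[_]_ : Seq → ℕ → Seq → Set
s ~[ l ] t = ∀ a b → a < l → b < l → val s a < val s b → val t a < val t b

~-refl : ∀ s {l} → s ~[ l ] s
~-refl s a b _ _ lt = lt

~-sym : ∀ s t {l} → s ~[ l ] t → t ~[ l ] s
~-sym s t p a b a<l b<l lt with <-cmp (val s a) (val s b)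
... | tri< sa<sb _ _ = sa<sb
... | tri≈ _ eq _    = contradiction lt (<-irrefl (cong (val t) (inj s eq)))
... | tri> _ _ sb<sa = contradiction lt (<-asym (p b a b<l a<l sb<sa))

~-trans : ∀ s t u {l} → s ~[ l ] t → t ~[ l ] u → s ~[ l ] u
~-trans s t u p q a b a<l b<l = q a b a<l b<l ∘ p a b a<l b<l

~-weaken : ∀ s t {l l′} → l′ ≤ l → s ~[ l ] t → s ~[ l′ ] t
~-weaken s t le p a b a<l b<l = p a b (<-≤-trans a<l le) (<-≤-trans b<l le)

~-shift : ∀ s t {l} i → s ~[ i + l ] t → shift i s ~[ l ] shift i t
~-shift s t i p a b a<l b<l = p (i + a) (i + b) (+-monoʳ-< i a<l) (+-monoʳ-< i b<l)

~-offset : ∀ s t {l} c → (∀ a → a < l → val s a ≡ c + val t a) → s ~[ l ] t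
~-offset s t c eq a b a<l b<l lt =
  +-cancelˡ-< c _ _ (subst₂ _<_ (eq a a<l) (eq b b<l) lt)

-- As `a` may also lie below `K`, each entry from position `K` on exceeds all earlier ones: up to
-- order, `s` is its prefix of length `K` followed by ⊕ 1 ⊕ 1 ⊕ ⋯.
IncreasingFrom : ℕ → Seq → Set
IncreasingFrom K s = ∀ {a b} → a < b → K ≤ b → val s a < val s b

-- A comparison that involves a position from `K` on is decided by the positions alone, in the same
-- way for both sequences.
tail-~ : ∀ {K} s t → IncreasingFrom K s → IncreasingFrom K t → s ~[ K ] t → ∀ {l} → s ~[ l ] t
tail-~ {K} s t inc-s inc-t p a b _ _ lt with a <? K | b <? K
... | yes a<K | yes b<K = p a b a<K b<K lt
... | no a≮K | yes b<K =
  contradiction lt (<-asym (inc-s (<-≤-trans b<K (≮⇒≥ a≮K)) (≮⇒≥ a≮K)))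
... | yes a<K | no b≮K = inc-t (<-≤-trans a<K (≮⇒≥ b≮K)) (≮⇒≥ b≮K)
... | no a≮K | no b≮K with <-cmp a b
...   | tri< a<b _ _ = inc-t a<b (≮⇒≥ b≮K)
...   | tri≈ _ eq _  = contradiction lt (<-irrefl (cong (val s) eq))
...   | tri> _ _ b<a = contradiction lt (<-asym (inc-s b<a (≮⇒≥ a≮K)))

-- Standardisation

rank : Seq → ℕ → ℕ → ℕ
rank s l a = ∑< l (λ b → ι (val s b <? val s a))

-- The index `a` does not count itself, so at least one of the `l` indicators vanishes.
rank<l : ∀ s {l a} → a < l → rank s l a < l
rank<l s {l} {a} a<l = subst (rank s l a <_) (trans (∑<-const l 1) (*-identityʳ l))
  (∑<-mono-< l (λ i _ → ι≤1 (val s i <? val s a)) a<l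
    (subst (_< 1) (sym (ι-no (val s a <? val s a) (<-irrefl refl))) ≤-refl))

-- Whatever is counted for `a` is counted for `b`, and `a` itself is counted for `b` only.
rank-mono : ∀ s {l a b} → a < l → val s a < val s b → rank s l a < rank s l b
rank-mono s {l} {a} {b} a<l lt = ∑<-mono-< l le a<l
  (subst₂ _<_ (sym (ι-no (val s a <? val s a) (<-irrefl refl)))
              (sym (ι-yes (val s a <? val s b) lt)) ≤-refl)
  where
  le : ∀ i → i < l → ι (val s i <? val s a) ≤ ι (val s i <? val s b)
  le i _ with val s i <? val s a
  ... | yes i<a = ≤-reflexive (sym (ι-yes (val s i <? val s b) (<-trans i<a lt)))
  ... | no _    = z≤n

rank-injective : ∀ s {l a b} → a < l → b < l → rank s l a ≡ rank s l b → a ≡ b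
rank-injective s {l} {a} {b} a<l b<l eq with <-cmp (val s a) (val s b)
... | tri< lt _ _ = contradiction (rank-mono s a<l lt) (<-irrefl eq)
... | tri≈ _ e _  = inj s e
... | tri> _ _ gt = contradiction (rank-mono s b<l gt) (<-irrefl (sym eq))

rank-cong : ∀ s t {l} → s ~[ l ] t → ∀ {a} → a < l → rank s l a ≡ rank t l a
rank-cong s t {l} p {a} a<l = ∑<-cong l λ i i<l →
  ι-cong (val s i <? val s a) (val t i <? val t a) (p i a i<l a<l) (~-sym s t p i a i<l a<l)

abstract

  std : Seq → ∀ l → Perm l
  std s l = mkPerm (tabulate r) (VecUnique.tabulate⁺ r-injective)
    where
    r : Fin l → Fin l
    r a = fromℕ< (rank<l s (Fin.toℕ<n a))
    r-injective : ∀ {a b} → r a ≡ r b → a ≡ b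
    r-injective {a} {b} eq = Fin.toℕ-injective (rank-injective s (Fin.toℕ<n a) (Fin.toℕ<n b)
      (Fin.fromℕ<-injective _ _ (rank<l s (Fin.toℕ<n a)) (rank<l s (Fin.toℕ<n b)) eq))

  std-at : ∀ s {l} (a : Fin l) → toℕ (std s l at a) ≡ rank s l (toℕ a)
  std-at s a = trans (cong toℕ (Vec.lookup∘tabulate _ a)) (Fin.toℕ-fromℕ< (rank<l s (Fin.toℕ<n a)))

word-injective : ∀ {m} {σ τ : Perm m} → word σ ≡ word τ → σ ≡ τ
word-injective {σ = mkPerm w _} {mkPerm .w _} refl = refl

at-injective : ∀ {m} (σ : Perm m) {a b} → σ at a ≡ σ at b → a ≡ b
at-injective (mkPerm w u) = VecUnique.lookup-injective (recompute (unique? w) u) _ _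

perm-ext : ∀ {m} {σ τ : Perm m} → (∀ a → toℕ (σ at a) ≡ toℕ (τ at a)) → σ ≡ τ
perm-ext {σ = σ} {τ} eq = word-injective (trans (sym (Vec.tabulate∘lookup (word σ)))
  (trans (Vec.tabulate-cong λ a → Fin.toℕ-injective (eq a)) (Vec.tabulate∘lookup (word τ))))

std-cong : ∀ s t {l} → s ~[ l ] t → std s l ≡ std t l
std-cong s t p = perm-ext λ a →
  trans (std-at s a) (trans (rank-cong s t p (Fin.toℕ<n a)) (sym (std-at t a)))

-- Pigeonhole: punching out a missed value would give an injection into a set with one element
-- fewer.
at-surjective : ∀ {m} (σ : Perm m) v → ¬ (∀ a → v ≢ σ at a)
at-surjective {suc m} σ v missed = <-irrefl refl (Fin.injective⇒≤ {f = λ a → punchOut (missed a)}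
  λ {a} {b} eq → at-injective σ (Fin.punchOut-injective (missed a) (missed b) eq))

-- The direct sum σ ⊕ 1 ⊕ 1 ⊕ ⋯.
ext : ∀ {m} → Perm m → Seq
ext {m} σ = mkSeq v v-injective
  where
  v : ℕ → ℕ
  v i with i <? m
  ... | yes i<m = toℕ (σ at fromℕ< i<m)
  ... | no _    = i
  v-injective : ∀ {a b} → v a ≡ v b → a ≡ b
  v-injective {a} {b} eq with a <? m | b <? m
  ... | yes a<m | yes b<m =
    Fin.fromℕ<-injective a b a<m b<m (at-injective σ (Fin.toℕ-injective eq))
  ... | yes a<m | no b≮m = contradiction (subst (_< m) eq (Fin.toℕ<n (σ at fromℕ< a<m))) b≮m
  ... | no a≮m | yes b<m = contradiction (subst (_< m) (sym eq) (Fin.toℕ<n (σ at fromℕ< b<m))) a≮m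
  ... | no _ | no _ = eq

module _ {m : ℕ} (σ : Perm m) where

  ext-fromℕ< : ∀ {i} (i<m : i < m) → val (ext σ) i ≡ toℕ (σ at fromℕ< i<m)
  ext-fromℕ< {i} i<m with i <? m
  ... | yes _  = refl
  ... | no i≮m = contradiction i<m i≮m

  ext-toℕ : ∀ a → val (ext σ) (toℕ a) ≡ toℕ (σ at a)
  ext-toℕ a = trans (ext-fromℕ< (Fin.toℕ<n a)) (cong (λ b → toℕ (σ at b)) (Fin.fromℕ<-toℕ a (Fin.toℕ<n a)))

  ext-< : ∀ {i} → i < m → val (ext σ) i < m
  ext-< i<m = subst (_< m) (sym (ext-fromℕ< i<m)) (Fin.toℕ<n _)

  ext-≥ : ∀ {i} → m ≤ i → val (ext σ) i ≡ i
  ext-≥ {i} m≤i with i <? m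
  ... | yes i<m = contradiction m≤i (<⇒≱ i<m)
  ... | no _    = refl

  ext-increasing : IncreasingFrom m (ext σ)
  ext-increasing {a} {b} a<b m≤b with a <? m
  ... | yes a<m = <-≤-trans (Fin.toℕ<n (σ at fromℕ< a<m)) (subst (m ≤_) (sym (ext-≥ m≤b)) m≤b)
  ... | no _    = subst (a <_) (sym (ext-≥ m≤b)) a<b

  ext-surjective : ∀ {v} → v < m → ∃[ i ] i < m × val (ext σ) i ≡ v
  ext-surjective {v} v<m with Fin.any? (λ a → σ at a Fin.≟ fromℕ< v<m)
  ... | yes (a , eq) = toℕ a , Fin.toℕ<n a ,
    trans (ext-toℕ a) (trans (cong toℕ eq) (Fin.toℕ-fromℕ< v<m))
  ... | no missed = contradiction (λ a eq → missed (a , sym eq)) (at-surjective σ (fromℕ< v<m))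

  -- Raising the threshold from v to v + 1 admits exactly one more position, the one at which σ
  -- takes the value v. Hence the rank of an entry of a permutation is its value.
  ∑-below : ∀ v → v ≤ m → ∑< m (λ b → ι (val (ext σ) b <? v)) ≡ v
  ∑-below zero    _   = ∑<-zero m λ i _ → ι-no (val (ext σ) i <? 0) λ ()
  ∑-below (suc v) v<m with ext-surjective v<m
  ... | c , c<m , σc≡v = trans (∑<-cong m step)
    (trans (∑<-distrib-+ m _ _)
    (trans (cong₂ _+_ (∑-below v (<⇒≤ v<m)) (trans (∑<-unique m _ c<m off) (ι-yes (val (ext σ) c ≟ v) σc≡v)))
    (+-comm v 1)))
    where
    step : ∀ i → i < m → ι (val (ext σ) i <? suc v) ≡ ι (val (ext σ) i <? v) + ι (val (ext σ) i ≟ v)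
    step i _ with <-cmp (val (ext σ) i) v
    ... | tri< lt ≢v _ = trans (ι-yes (val (ext σ) i <? suc v) (m<n⇒m<1+n lt))
      (sym (cong₂ _+_ (ι-yes (val (ext σ) i <? v) lt) (ι-no (val (ext σ) i ≟ v) ≢v)))
    ... | tri≈ ≮v eq _ = trans (ι-yes (val (ext σ) i <? suc v) (s≤s (≤-reflexive eq)))
      (sym (cong₂ _+_ (ι-no (val (ext σ) i <? v) ≮v) (ι-yes (val (ext σ) i ≟ v) eq)))
    ... | tri> ≮v ≢v gt = trans (ι-no (val (ext σ) i <? suc v) (λ lt → <⇒≱ gt (s≤s⁻¹ lt)))
      (sym (cong₂ _+_ (ι-no (val (ext σ) i <? v) ≮v) (ι-no (val (ext σ) i ≟ v) ≢v)))
    off : ∀ i → i < m → i ≢ c → ι (val (ext σ) i ≟ v) ≡ 0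
    off i _ i≢c = ι-no (val (ext σ) i ≟ v) λ eq → i≢c (inj (ext σ) (trans eq (sym σc≡v)))

  std-ext : std (ext σ) m ≡ σ
  std-ext = perm-ext λ a → trans (std-at (ext σ) a)
    (trans (∑-below (val (ext σ) (toℕ a)) (<⇒≤ (ext-< (Fin.toℕ<n a)))) (ext-toℕ a))

ext-std-val : ∀ s {l a} → a < l → val (ext (std s l)) a ≡ rank s l a
ext-std-val s {l} {a} a<l = trans (ext-fromℕ< (std s l) a<l)
  (trans (std-at s (fromℕ< a<l)) (cong (rank s l) (Fin.toℕ-fromℕ< a<l)))

~-ext-std : ∀ s l → s ~[ l ] ext (std s l)
~-ext-std s l a b a<l b<l lt =
  subst₂ _<_ (sym (ext-std-val s a<l)) (sym (ext-std-val s b<l)) (rank-mono s a<l lt)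

ext-std-~ : ∀ s l → ext (std s l) ~[ l ] s
ext-std-~ s l = ~-sym s (ext (std s l)) (~-ext-std s l)

std-std : ∀ s {l l′} → l′ ≤ l → std (ext (std s l)) l′ ≡ std s l′
std-std s {l} le = std-cong (ext (std s l)) s (~-weaken (ext (std s l)) s le (ext-std-~ s l))

infix 4 _≟ₚ_

abstract

  _≟ₚ_ : ∀ {m} (σ τ : Perm m) → Dec (σ ≡ τ)
  σ ≟ₚ τ = map′ word-injective (cong word) (Vec.≡-dec Fin._≟_ (word σ) (word τ))

-- Occurrences of consecutive patterns

~-fin : ∀ s t {l} →
  (∀ (a b : Fin l) → val s (toℕ a) < val s (toℕ b) → val t (toℕ a) < val t (toℕ b)) →
  s ~[ l ] t
~-fin s t p a b a<l b<l lt =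
  subst₂ (λ x y → val t x < val t y) (Fin.toℕ-fromℕ< a<l) (Fin.toℕ-fromℕ< b<l)
    (p (fromℕ< a<l) (fromℕ< b<l)
      (subst₂ (λ x y → val s x < val s y)
        (sym (Fin.toℕ-fromℕ< a<l)) (sym (Fin.toℕ-fromℕ< b<l)) lt))

at-interval : ∀ {m k} (σ : Perm m) i (i+k≤m : toℕ i + k ≤ m) (a : Fin k) →
  val (shift (toℕ i) (ext σ)) (toℕ a) ≡ toℕ (σ at lookup (interval k i i+k≤m) a)
at-interval {m} σ i i+k≤m a = trans (ext-fromℕ< σ i+a<m)
  (cong (λ b → toℕ (σ at b)) (sym (Vec.lookup∘tabulate _ a)))
  where
  i+a<m : toℕ i + toℕ a < m
  i+a<m = ≤-trans (+-monoʳ-< (toℕ i) (Fin.toℕ<n a)) i+k≤m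

module _ {m k : ℕ} (π : Perm k) (σ : Perm m) (i : Fin m) where

  private
    s = shift (toℕ i) (ext σ)

  -- `Pat` makes the window order-isomorphic to `ext π`, whose standardisation is π. Occurrences
  -- thus become equations between permutations.
  occursAt⇒std≡ : OccursAt π σ i → std s k ≡ π
  occursAt⇒std≡ (i+k≤m , pat) = trans (sym (std-cong (ext π) s (~-fin (ext π) s λ a b lt →
    subst₂ _<_ (sym (at-interval σ i i+k≤m a)) (sym (at-interval σ i i+k≤m b))
      (Equivalence.to (pat a b) (subst₂ _<_ (ext-toℕ π a) (ext-toℕ π b) lt))))) (std-ext π)

  std≡⇒occursAt : toℕ i + k ≤ m → std s k ≡ π → OccursAt π σ i
  std≡⇒occursAt i+k≤m refl = i+k≤m , λ a b → mk⇔
    (λ lt → subst₂ _<_ (at-interval σ i i+k≤m a) (at-interval σ i i+k≤m b)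
      (ext-std-~ s k _ _ (Fin.toℕ<n a) (Fin.toℕ<n b)
        (subst₂ _<_ (sym (ext-toℕ π a)) (sym (ext-toℕ π b)) lt)))
    (λ lt → subst₂ _<_ (ext-toℕ π a) (ext-toℕ π b)
      (~-ext-std s k _ _ (Fin.toℕ<n a) (Fin.toℕ<n b)
        (subst₂ _<_ (sym (at-interval σ i i+k≤m a)) (sym (at-interval σ i i+k≤m b)) lt)))

length-filter-tabulate : ∀ {A : Set} {P : A → Set} (P? : Decidable P) n (f : Fin n → A) (q : ℕ → ℕ) →
  (∀ i → ι (P? (f i)) ≡ q (toℕ i)) → length (filter P? (List.tabulate f)) ≡ ∑< n q
length-filter-tabulate P? zero    f q eq = refl
length-filter-tabulate P? (suc n) f q eq =
  trans (step (eq zero)) (sym (∑<-head n q))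
  where
  ih = length-filter-tabulate P? n (f ∘ suc) (q ∘ suc) (eq ∘ suc)
  step : ι (P? (f zero)) ≡ q 0 →
    length (filter P? (f zero ∷ List.tabulate (f ∘ suc))) ≡ q 0 + ∑< n (q ∘ suc)
  step with P? (f zero)
  ... | yes _ = λ e → cong₂ _+_ e ih
  ... | no _  = λ e → cong₂ _+_ e ih

occ : ∀ {k} → Perm k → Seq → ℕ → ℕ
occ {k} τ s i = ι (std (shift i s) k ≟ₚ τ)

occ-cong : ∀ {k} (τ : Perm k) s t i j → shift i s ~[ k ] shift j t → occ τ s i ≡ occ τ t j
occ-cong τ s t i j p = cong (λ π → ι (π ≟ₚ τ)) (std-cong (shift i s) (shift j t) p)

occ≤1 : ∀ {k} (τ : Perm k) s i → occ τ s i ≤ 1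
occ≤1 τ s i = ι≤1 (std (shift i s) _ ≟ₚ τ)

-- `m ∸ K` is the number of starting points of windows of length K + 1; truncated subtraction gives
-- 0 when m ≤ K.
window-fits : ∀ {m K i} → i < m ∸ K → i + suc K ≤ m
window-fits {m} {K} {i} i<m∸K = subst (_≤ m) (sym (+-suc i K))
  (subst (suc i + K ≤_) (m∸n+n≡m (<⇒≤ K<m)) (+-monoˡ-≤ K i<m∸K))
  where
  K<m : K < m
  K<m = ≰⇒> λ m≤K → <⇒≱ i<m∸K (subst (_≤ i) (sym (m≤n⇒m∸n≡0 m≤K)) z≤n)

m∸[m∸n]≤n : ∀ m n → m ∸ (m ∸ n) ≤ n
m∸[m∸n]≤n m n = m≤n+o⇒m∸n≤o m (m ∸ n) (subst (m ≤_) (+-comm n (m ∸ n)) (m≤n+m∸n m n))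

c-occ≡∑ : ∀ {m K} (τ : Perm (suc K)) (σ : Perm m) → c-occ τ σ ≡ ∑< (m ∸ K) (occ τ (ext σ))
c-occ≡∑ {m} {K} τ σ = trans
  (length-filter-tabulate (occursAt? τ σ) m id q λ i →
    ι-cong (occursAt? τ σ i) (Q? (toℕ i))
      (λ o → proj₁ o , occursAt⇒std≡ τ σ i o)
      (λ (i+k≤m , eq) → std≡⇒occursAt τ σ i i+k≤m eq))
  (∑<-truncate (m∸n≤m m K) q (occ τ (ext σ))
    (λ i i<m∸K → ι-cong (Q? i) (std (shift i (ext σ)) (suc K) ≟ₚ τ) proj₂
      (window-fits i<m∸K ,_))
    -- From `m ∸ K` on a window would leave σ. `occ` would still count windows of `ext σ` there, so
    -- the condition that the window fits is kept in `Q?`.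
    (λ i m∸K≤i _ → ι-no (Q? i) λ (i+k≤m , _) →
      <⇒≱ (m+n≤o⇒m≤o∸n (suc i) (subst (_≤ m) (+-suc i K) i+k≤m)) m∸K≤i))
  where
  Q? : ∀ i → Dec (i + suc K ≤ m × std (shift i (ext σ)) (suc K) ≡ τ)
  Q? i = i + suc K ≤? m ×-dec std (shift i (ext σ)) (suc K) ≟ₚ τ
  q : ℕ → ℕ
  q = ι ∘ Q?

-- Decreasing subsequences

Descent : Seq → ℕ → ℕ → Set
Descent s l n = Σ (Fin n → ℕ) λ I → (∀ a → I a < l) ×
  (∀ a b → a Fin.< b → I a < I b × val s (I b) < val s (I a))

descent-~ : ∀ s t {l n} → s ~[ l ] t → Descent s l n → Descent t l n
descent-~ s t p (I , I<l , desc) = I , I<l , λ a b a<b →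
  proj₁ (desc a b a<b) , p (I b) (I a) (I<l b) (I<l a) (proj₂ (desc a b a<b))

descent-shift : ∀ s {l m n} i → i + l ≤ m → Descent (shift i s) l n → Descent s m n
descent-shift s i le (I , I<l , desc) =
  (λ a → i + I a) , (λ a → <-≤-trans (+-monoʳ-< i (I<l a)) le) , λ a b a<b →
  +-monoʳ-< i (proj₁ (desc a b a<b)) , proj₂ (desc a b a<b)

-- The first position of the subsequence forms an inversion with every later one, so the block
-- assigned to it contains all of them. Since n ≥ 2 there is a later position, which bounds the
-- first one as well.
descent-block : ∀ s {l n} k (base : ℕ → ℕ) → 2 ≤ n →
  (∀ {i j} → i < j → val s j < val s i → base i ≤ i × j < base i + k) →
  Descent s l n → ∃[ i ] Descent (shift (base i) s) k n
descent-block s k base (s≤s (s≤s _)) block (I , _ , desc) = I zero ,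
  (λ a → I a ∸ o) ,
  (λ a → subst (I a ∸ o <_) (m+n∸m≡n o k) (∸-monoˡ-< (I<o+k a) (o≤I a))) ,
  λ a b a<b → ∸-monoˡ-< (proj₁ (desc a b a<b)) (o≤I a) ,
    subst₂ (λ x y → val s x < val s y) (sym (m+[n∸m]≡n (o≤I b))) (sym (m+[n∸m]≡n (o≤I a)))
      (proj₂ (desc a b a<b))
  where
  o = base (I zero)
  inversion : ∀ a → 0 < toℕ a → o ≤ I zero × I a < o + k
  inversion a 0<a = block {I zero} {I a} (proj₁ (desc zero a 0<a)) (proj₂ (desc zero a 0<a))
  o≤I : ∀ a → o ≤ I a
  o≤I zero    = proj₁ (inversion (suc zero) (s≤s z≤n))
  o≤I (suc a) = ≤-trans (o≤I zero) (<⇒≤ (proj₁ (desc zero (suc a) (s≤s z≤n))))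
  I<o+k : ∀ a → I a < o + k
  I<o+k zero    = <-trans (proj₁ (desc zero (suc zero) (s≤s z≤n))) (I<o+k (suc zero))
  I<o+k (suc a) = proj₂ (inversion (suc a) (s≤s z≤n))

↘-at : ∀ n (a : Fin n) → ↘ n at a ≡ opposite a
↘-at n a = Vec.lookup∘tabulate opposite a

opposite-anti : ∀ {n} {a b : Fin n} → a Fin.< b → opposite b Fin.< opposite a
opposite-anti {n} {a} {b} a<b = subst₂ _<_ (sym (Fin.opposite-prop b)) (sym (Fin.opposite-prop a))
  (∸-monoʳ-< (s≤s a<b) (Fin.toℕ<n b))

↘-anti : ∀ {n} {a b : Fin n} → a Fin.< b → ↘ n at b Fin.< ↘ n at a
↘-anti {n} {a} {b} a<b = subst₂ Fin._<_ (sym (↘-at n b)) (sym (↘-at n a)) (opposite-anti a<b)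

module _ {m n : ℕ} {σ : Perm m} where

  ¬descent⇒avoids : ¬ Descent (ext σ) m n → σ avoids ↘ n
  ¬descent⇒avoids ¬desc (I , inc , pat) = ¬desc
    ( (λ a → toℕ (lookup I a))
    , (λ a → Fin.toℕ<n (lookup I a))
    , λ a b a<b → inc a b a<b ,
        subst₂ _<_ (sym (ext-toℕ σ (lookup I b))) (sym (ext-toℕ σ (lookup I a)))
          (Equivalence.to (pat b a) (↘-anti a<b)))

  avoids⇒¬descent : σ avoids ↘ n → ¬ Descent (ext σ) m n
  avoids⇒¬descent av (J , J<m , desc) = av (tabulate I ,
    (λ a b a<b → subst₂ Fin._<_ (sym (Vec.lookup∘tabulate I a)) (sym (Vec.lookup∘tabulate I b))
      (subst₂ _<_ (sym (Fin.toℕ-fromℕ< (J<m a))) (sym (Fin.toℕ-fromℕ< (J<m b))) (proj₁ (desc a b a<b)))) ,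
    λ a b → subst₂ (λ x y → (↘ n at a Fin.< ↘ n at b) ⇔ (σ at x Fin.< σ at y))
      (sym (Vec.lookup∘tabulate I a)) (sym (Vec.lookup∘tabulate I b)) (mk⇔ (to a b) (from a b)))
    where
    I : Fin n → Fin m
    I a = fromℕ< (J<m a)
    anti : ∀ {a b} → a Fin.< b → σ at I b Fin.< σ at I a
    anti {a} {b} a<b = subst₂ _<_ (ext-fromℕ< σ (J<m b)) (ext-fromℕ< σ (J<m a)) (proj₂ (desc a b a<b))
    to : ∀ a b → ↘ n at a Fin.< ↘ n at b → σ at I a Fin.< σ at I b
    to a b lt with Fin.<-cmp a b
    ... | tri< a<b _ _  = contradiction lt (<-asym (↘-anti a<b))
    ... | tri≈ _ refl _ = contradiction lt (<-irrefl refl)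
    ... | tri> _ _ b<a  = anti b<a
    from : ∀ a b → σ at I a Fin.< σ at I b → ↘ n at a Fin.< ↘ n at b
    from a b lt with Fin.<-cmp a b
    ... | tri< a<b _ _  = contradiction lt (<-asym (anti a<b))
    ... | tri≈ _ refl _ = contradiction lt (<-irrefl refl)
    ... | tri> _ _ b<a  = ↘-anti b<a

std-avoids : ∀ s {l n} → ¬ Descent s l n → std s l avoids ↘ n
std-avoids s {l} ¬desc = ¬descent⇒avoids {σ = std s l}
  (¬desc ∘ descent-~ (ext (std s l)) s (ext-std-~ s l))

window-avoids : ∀ {m n} {σ : Perm m} {i l} → i + l ≤ m → σ avoids ↘ n → std (shift i (ext σ)) l avoids ↘ n
window-avoids {σ = σ} {i} le av = std-avoids (shift i (ext σ))
  (avoids⇒¬descent {σ = σ} av ∘ descent-shift (ext σ) i le)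

-- No inversion of σ ⊕ 1 ⊕ 1 ⊕ ⋯ reaches beyond σ, so the single block of the first m positions
-- serves in `descent-block`.
ext-avoids : ∀ {m n l} {σ : Perm m} → 2 ≤ n → σ avoids ↘ n → std (ext σ) l avoids ↘ n
ext-avoids {m} {σ = σ} 2≤n av = std-avoids (ext σ) λ desc →
  avoids⇒¬descent {σ = σ} av (descent-~ (shift 0 (ext σ)) (ext σ) (~-refl (ext σ))
    (proj₂ (descent-block (ext σ) m (λ _ → 0) 2≤n
      (λ i<j lt → z≤n , ≰⇒> λ m≤j → <-asym lt (ext-increasing σ i<j m≤j)) desc)))

-- Prepending an increasing run

module _ (k : ℕ) where

  -- The direct sum id_k ⊕ s.
  lead : Seq → Seq
  lead s = mkSeq v v-injective
    where
    v : ℕ → ℕ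
    v i with i <? k
    ... | yes _ = i
    ... | no _  = k + val s (i ∸ k)
    v-injective : ∀ {a b} → v a ≡ v b → a ≡ b
    v-injective {a} {b} eq with a <? k | b <? k
    ... | yes a<k | yes b<k = eq
    ... | yes a<k | no _    = contradiction (subst (_< k) eq a<k) (m+n≮m k _)
    ... | no _    | yes b<k = contradiction (subst (_< k) (sym eq) b<k) (m+n≮m k _)
    ... | no a≮k  | no b≮k  = ∸-cancelʳ-≡ (≮⇒≥ a≮k) (≮⇒≥ b≮k) (inj s (+-cancelˡ-≡ k _ _ eq))

  lead-< : ∀ s {i} → i < k → val (lead s) i ≡ i
  lead-< s {i} i<k with i <? k
  ... | yes _  = refl
  ... | no i≮k = contradiction i<k i≮k

  lead-+ : ∀ s j → val (lead s) (k + j) ≡ k + val s j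
  lead-+ s j with k + j <? k
  ... | yes lt = contradiction lt (m+n≮m k j)
  ... | no _   = cong (λ x → k + val s x) (m+n∸m≡n k j)

  -- An entry of the leading run is smaller than everything after it and cannot begin an inversion.
  lead-inversion : ∀ s {i j} → i < j → val (lead s) j < val (lead s) i → k ≤ i
  lead-inversion s {i} {j} i<j lt = ≮⇒≥ λ i<k → <-asym lt (ascent i<k)
    where
    ascent : i < k → val (lead s) i < val (lead s) j
    ascent i<k with j <? k
    ... | yes _ = subst (_< j) (sym (lead-< s i<k)) i<j
    ... | no _  = subst (_< k + val s (j ∸ k)) (sym (lead-< s i<k)) (<-≤-trans i<k (m≤m+n k _))

  lead-~ : ∀ s t {l} → s ~[ l ] t → lead s ~[ k + l ] lead t
  lead-~ s t {l} p a b a<k+l b<k+l lt with a <? k | b <? k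
  ... | yes _   | yes _   = lt
  ... | yes a<k | no _    = <-≤-trans a<k (m≤m+n k _)
  ... | no _    | yes b<k = contradiction (<-trans lt b<k) (m+n≮m k _)
  ... | no a≮k  | no b≮k  = +-monoʳ-< k (p (a ∸ k) (b ∸ k) (below a≮k a<k+l) (below b≮k b<k+l)
                              (+-cancelˡ-< k _ _ lt))
    where
    below : ∀ {x} → ¬ x < k → x < k + l → x ∸ k < l
    below {x} x≮k x<k+l = subst (x ∸ k <_) (m+n∸m≡n k l) (∸-monoˡ-< x<k+l (≮⇒≥ x≮k))

-- The periodic direct sum (id_k ⊕ π) ⊕ (id_k ⊕ π) ⊕ ⋯

module Periodic {K : ℕ} (π : Perm (suc K)) where

  private
    k P : ℕ
    k = suc K
    P = k + k

  block : Seq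
  block = lead k (ext π)

  block<P : ∀ {r} → r < P → val block r < P
  block<P {r} r<P with r <? k
  ... | yes r<k = <-≤-trans r<k (m≤m+n k k)
  ... | no r≮k  = +-monoʳ-< k (ext-< π (subst (r ∸ k <_) (m+n∸m≡n k k) (∸-monoˡ-< r<P (≮⇒≥ r≮k))))

  private
    -- Consecutive copies of the first P entries of `block`, each raised above all earlier copies.
    v : ℕ → ℕ
    v i = (i / P) * P + val block (i % P)

    v-mono : ∀ {i j} → i / P < j / P → v i < v j
    v-mono {i} {j} lt = <-≤-trans (+-monoʳ-< ((i / P) * P) (block<P (m%n<n i P)))
      (≤-trans (≤-trans (≤-reflexive (+-comm _ P)) (*-monoˡ-≤ P lt)) (m≤m+n _ _))

    same-block : ∀ {i j} → v i ≡ v j → i / P ≡ j / P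
    same-block {i} {j} eq with <-cmp (i / P) (j / P)
    ... | tri< lt _ _ = contradiction (v-mono {i} {j} lt) (<-irrefl eq)
    ... | tri≈ _ e _  = e
    ... | tri> _ _ gt = contradiction (v-mono {j} {i} gt) (<-irrefl (sym eq))

    recompose : ∀ i j → i / P ≡ j / P → i % P ≡ j % P → i ≡ j
    recompose i j q r = trans (m≡m%n+[m/n]*n i P)
      (trans (cong₂ (λ x y → x + y * P) r q) (sym (m≡m%n+[m/n]*n j P)))

  periodic : Seq
  periodic = mkSeq v λ {i} {j} eq → recompose i j (same-block {i} {j} eq)
    (inj block (+-cancelˡ-≡ ((j / P) * P) _ _
      (trans (cong (λ q → q * P + val block (i % P)) (sym (same-block {i} {j} eq))) eq)))

  periodic-+ : ∀ i → val periodic (P + i) ≡ P + val periodic i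
  periodic-+ i = trans (cong₂ (λ q r → q * P + val block r)
      (trans (+-distrib-/-∣ˡ i {P} ∣-refl) (cong (_+ i / P) (n/n≡1 P)))
      (trans (cong (_% P) (+-comm P i)) ([m+n]%n≡m%n i P)))
    (+-assoc P _ _)

  periodic-* : ∀ q {r} → r < P → val periodic (r + q * P) ≡ q * P + val block r
  periodic-* q {r} r<P = cong₂ (λ x y → x * P + val block y)
    (trans (+-distrib-/-∣ʳ r (n∣m*n q)) (cong₂ _+_ (m<n⇒m/n≡0 r<P) (m*n/n≡m q P)))
    (trans ([m+kn]%n≡m%n r q P) (m<n⇒m%n≡m r<P))

  periodic-block : ∀ {i} → i < P → val periodic i ≡ val block i
  periodic-block {i} i<P = trans (cong v (sym (+-identityʳ i))) (periodic-* 0 i<P)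

  -- After the first P entries the periodic sequence continues with the leading run of the next
  -- copy, and `block` = id_k ⊕ π ⊕ 1 ⊕ ⋯ continues with the same values. Hence a window of length k
  -- starting in the first copy is a window of `block`.
  periodic-block₊ : ∀ {i} → i < P + k → val periodic i ≡ val block i
  periodic-block₊ {i} i<P+k with i <? P
  ... | yes i<P = periodic-block i<P
  ... | no i≮P  = subst (λ x → val periodic x ≡ val block x) (m+[n∸m]≡n (≮⇒≥ i≮P)) (beyond y<k)
    where
    y<k : i ∸ P < k
    y<k = subst (i ∸ P <_) (m+n∸m≡n P k) (∸-monoˡ-< i<P+k (≮⇒≥ i≮P))
    beyond : ∀ {y} → y < k → val periodic (P + y) ≡ val block (P + y)
    beyond {y} y<k = trans (periodic-+ y)
      (trans (cong (P +_) (trans (periodic-block (<-≤-trans y<k (m≤m+n k k))) (lead-< k (ext π) y<k)))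
      (trans (+-assoc k k y)
      (trans (cong (k +_) (sym (ext-≥ π (m≤m+n k y))))
      (trans (sym (lead-+ k (ext π) (k + y)))
      (cong (val block) (sym (+-assoc k k y)))))))

  periodic-window : ∀ {i} → i < P → shift i periodic ~[ k ] shift i block
  periodic-window {i} i<P = ~-offset (shift i periodic) (shift i block) 0
    λ a a<k → periodic-block₊ (+-mono-< i<P a<k)

  periodic-shift : ∀ i → shift (P + i) periodic ~[ k ] shift i periodic
  periodic-shift i = ~-offset (shift (P + i) periodic) (shift i periodic) P
    λ a _ → trans (cong v (+-assoc P i a)) (periodic-+ (i + a))

  private
    -- The position at which π begins in the copy of id_k ⊕ π that contains position i.
    base : ℕ → ℕ
    base i = k + (i / P) * P

    same-block-inversion : ∀ {i j} → i < j → v j < v i → i / P ≡ j / P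
    same-block-inversion {i} {j} i<j lt with m≤n⇒m<n∨m≡n (/-monoˡ-≤ P (<⇒≤ i<j))
    ... | inj₁ q<q′ = contradiction lt (<-asym (v-mono {i} {j} q<q′))
    ... | inj₂ eq   = eq

    -- Later copies lie above earlier ones, and inside a copy the leading run begins no inversion;
    -- what remains are inversions within π.
    inversion : ∀ {i j} → i < j → v j < v i → base i ≤ i × j < base i + k
    inversion {i} {j} i<j lt = base≤i , j<base+k
      where
      q = i / P
      q≡ : q ≡ j / P
      q≡ = same-block-inversion {i} {j} i<j lt
      i≡ : i ≡ i % P + q * P
      i≡ = m≡m%n+[m/n]*n i P
      j≡ : j ≡ j % P + q * P
      j≡ = trans (m≡m%n+[m/n]*n j P) (cong (λ x → j % P + x * P) (sym q≡))
      r<r′ : i % P < j % P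
      r<r′ = +-cancelʳ-< (q * P) _ _ (subst₂ _<_ i≡ j≡ i<j)
      t>t′ : val block (j % P) < val block (i % P)
      t>t′ = +-cancelˡ-< (q * P) _ _ (subst (λ x → x * P + val block (j % P) < v i) (sym q≡) lt)
      base≤i : base i ≤ i
      base≤i = subst (base i ≤_) (sym i≡) (+-monoˡ-≤ (q * P) (lead-inversion k (ext π) r<r′ t>t′))
      j<base+k : j < base i + k
      j<base+k = subst₂ _<_ (sym j≡)
        (trans (+-assoc k k (q * P)) (trans (cong (k +_) (+-comm k (q * P))) (sym (+-assoc k (q * P) k))))
        (+-monoˡ-< (q * P) (m%n<n j P))

    base-~ : ∀ i → shift (base i) periodic ~[ k ] ext π
    base-~ i = ~-offset (shift (base i) periodic) (ext π) (q * P + k) λ a a<k →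
      trans (cong v (trans (+-assoc k (q * P) a) (trans (cong (k +_) (+-comm (q * P) a)) (sym (+-assoc k a (q * P))))))
      (trans (periodic-* q (+-monoʳ-< k a<k))
      (trans (cong (q * P +_) (lead-+ k (ext π) a)) (sym (+-assoc (q * P) k _))))
      where q = i / P

  -- By `inversion`, a decreasing subsequence of length n ≥ 2 lies inside a single copy of π.
  periodic-avoids : ∀ {n} → 2 ≤ n → π avoids ↘ n → ∀ l → std periodic l avoids ↘ n
  periodic-avoids 2≤n av l = std-avoids periodic λ desc →
    let (i , d) = descent-block periodic k base 2≤n (λ {i} {j} → inversion {i} {j}) desc
    in avoids⇒¬descent {σ = π} av (descent-~ (shift (base i) periodic) (ext π) (base-~ i) d)

  -- The first k windows start in the leading run. The other k start in the copy of π and are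
  -- windows of π ⊕ 1 ⊕ 1 ⊕ ⋯.
  ∑-periodic : ∀ (τ : Perm k) → ∑< P (occ τ periodic) ≡ ∑< k (occ τ block) + ∑< k (occ τ (ext π))
  ∑-periodic τ = trans (∑<-cong P λ i i<P → occ-cong τ periodic block i i (periodic-window i<P))
    (trans (∑<-split k k (occ τ block))
    (cong (∑< k (occ τ block) +_) (∑<-cong k λ j _ →
      occ-cong τ block (ext π) (k + j) j (~-offset (shift (k + j) block) (shift j (ext π)) k
        λ a _ → trans (cong (val block) (+-assoc k j a)) (lead-+ k (ext π) (j + a))))))

open Periodic public using (periodic; periodic-shift; periodic-avoids; ∑-periodic)

id-avoids : ∀ {n} l → 2 ≤ n → std idSeq l avoids ↘ n
id-avoids l (s≤s (s≤s _)) = std-avoids idSeq λ (I , _ , desc) →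
  <-asym (proj₁ (desc zero (suc zero) (s≤s z≤n))) (proj₂ (desc zero (suc zero) (s≤s z≤n)))

-- Cardinalities of duplicate-free lists

length-filter-split : ∀ {A : Set} {P Q : A → Set} (P? : Decidable P) (Q? : Decidable Q) xs →
  length (filter (λ x → P? x ×-dec Q? x) xs) + length (filter (λ x → ¬? (P? x) ×-dec Q? x) xs) ≡
  length (filter Q? xs)
length-filter-split P? Q? []       = refl
length-filter-split P? Q? (x ∷ xs) with ih ← length-filter-split P? Q? xs | P? x | Q? x
... | yes _ | yes _ = cong suc ih
... | yes _ | no _  = ih
... | no _  | yes _ = trans (+-suc _ _) (cong suc ih)
... | no _  | no _  = ih

-- `List.map f xs` and `ys` are duplicate-free with the same elements, hence rearrangements of each
-- other.
length-bijection : ∀ {A B : Set} (f : A → B) → (∀ {x y} → f x ≡ f y → x ≡ y) →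
  ∀ {xs ys} → List.Unique xs → List.Unique ys →
  (∀ {x} → x ∈ xs → f x ∈ ys) → (∀ {y} → y ∈ ys → ∃[ x ] x ∈ xs × y ≡ f x) →
  length xs ≡ length ys
length-bijection f f-injective {xs} {ys} uxs uys to from = trans (sym (List.length-map f xs))
  (↭-length (∼bag⇒↭ (unique∧set⇒bag (ListUnique.map⁺ f-injective uxs) uys (mk⇔
    (λ y∈ → let (x , x∈ , eq) = ∈-map⁻ f y∈ in subst (_∈ ys) (sym eq) (to x∈))
    (λ y∈ → let (x , x∈ , eq) = from y∈ in subst (_∈ List.map f xs) (sym eq) (∈-map⁺ f x∈))))))

-- The overlap graph

module _ {K : ℕ} where

  private
    k : ℕ
    k = suc K

  beg end : Perm k → Perm K
  beg π = std (ext π) K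
  end π = std (shift 1 (ext π)) K

  -- ρ ⊕ 1
  top : Perm K → Perm k
  top ρ = std (ext ρ) k

  beg-std : ∀ s → beg (std s k) ≡ std s K
  beg-std s = std-std s (n≤1+n K)

  end-std : ∀ s → end (std s k) ≡ std (shift 1 s) K
  end-std s = std-cong (shift 1 (ext (std s k))) (shift 1 s)
    (~-shift (ext (std s k)) s 1 (ext-std-~ s k))

  beg-top : ∀ ρ → beg (top ρ) ≡ ρ
  beg-top ρ = trans (beg-std (ext ρ)) (std-ext ρ)

  increasing-~ : ∀ s → IncreasingFrom K s → ∀ {l} → s ~[ l ] ext (std s K)
  increasing-~ s inc = tail-~ s (ext (std s K)) inc (ext-increasing (std s K)) (~-ext-std s K)

  -- The last entry of such a window is its largest, so the first K entries determine the window.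
  -- The equation π = top (beg π) is how edges of the form ρ ⊕ 1 are recognised from here on.
  top-beg : ∀ s → IncreasingFrom K s → top (beg (std s k)) ≡ std s k
  top-beg s inc = trans (cong top (beg-std s))
    (sym (std-cong s (ext (std s K)) (increasing-~ s inc)))

  shift-increasing : ∀ s i → IncreasingFrom K s → IncreasingFrom K (shift i s)
  shift-increasing s i inc a<b K≤b = inc (+-monoʳ-< i a<b) (≤-trans K≤b (m≤n+m _ i))

  top-beg-shift : ∀ ρ i → top (beg (std (shift i (ext ρ)) k)) ≡ std (shift i (ext ρ)) k
  top-beg-shift ρ i = top-beg (shift i (ext ρ)) (shift-increasing (ext ρ) i (ext-increasing ρ))

  top-beg-top : ∀ ρ → top (beg (top ρ)) ≡ top ρ
  top-beg-top ρ = top-beg (ext ρ) (ext-increasing ρ)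

  top-beg-id : top (beg (std idSeq k)) ≡ std idSeq k
  top-beg-id = top-beg idSeq λ a<b _ → a<b

  -- The multiplicity of τ in the walk of length K from ρ to the identity
  -- through the windows of ρ ⊕ 1 ⊕ 1 ⊕ ⋯.
  path : Perm k → Perm K → ℕ
  path τ ρ = ∑< K (occ τ (ext ρ))

  path≤K : ∀ τ ρ → path τ ρ ≤ K
  path≤K τ ρ = subst (path τ ρ ≤_) (trans (∑<-const K 1) (*-identityʳ K))
    (∑<-mono-≤ K λ i _ → occ≤1 τ (ext ρ) i)

  -- Each window of ρ ⊕ 1 ⊕ 1 ⊕ ⋯ of length K + 1 ends beyond ρ, hence in its largest entry, and is
  -- itself of the form ρ′ ⊕ 1.
  path-off-tree : ∀ τ ρ → τ ≢ top (beg τ) → path τ ρ ≡ 0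
  path-off-tree τ ρ τ≢ = ∑<-zero K λ i _ → ι-no (std (shift i (ext ρ)) k ≟ₚ τ)
    λ { refl → τ≢ (sym (top-beg-shift ρ i)) }

  -- The first window is π. Dropping the first entry of π ⊕ 1 ⊕ 1 ⊕ ⋯ leaves the order of end π ⊕ 1
  -- ⊕ 1 ⊕ ⋯, so the remaining K windows are the path from end π.
  windows-end : ∀ τ π → ∑< k (occ τ (ext π)) ≡ ι (π ≟ₚ τ) + path τ (end π)
  windows-end τ π = trans (∑<-head K (occ τ (ext π))) (cong₂ _+_
    (cong (λ σ → ι (σ ≟ₚ τ)) (trans (std-cong (shift 0 (ext π)) (ext π) (~-refl (ext π))) (std-ext π)))
    (∑<-cong K λ j _ → occ-cong τ (ext π) (ext (end π)) (suc j) j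
      (~-shift (shift 1 (ext π)) (ext (end π)) j (increasing-~ (shift 1 (ext π))
        λ a<b K≤b → ext-increasing π (s≤s a<b) (s≤s K≤b)))))

  -- The sequences of top ρ and of ρ have the same order. Their first K windows form the path from
  -- ρ, and the window at position K lies entirely in the increasing tail.
  windows-top : ∀ τ ρ → ∑< k (occ τ (ext (top ρ))) ≡ path τ ρ + ι (std idSeq k ≟ₚ τ)
  windows-top τ ρ = trans (∑<-cong k λ j _ → occ-cong τ (ext (top ρ)) (ext ρ) j j
      (~-shift (ext (top ρ)) (ext ρ) j (~-sym (ext ρ) (ext (top ρ)) top~)))
    (cong (λ σ → path τ ρ + ι (σ ≟ₚ τ))
      (std-cong (shift K (ext ρ)) idSeq (~-offset (shift K (ext ρ)) idSeq K
        λ a _ → ext-≥ ρ (m≤m+n K a))))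
    where
    top~ : ∀ {l} → ext ρ ~[ l ] ext (top ρ)
    top~ = tail-~ (ext ρ) (ext (top ρ))
      (λ a<b k≤b → ext-increasing ρ a<b (≤-trans (n≤1+n K) k≤b))
      (ext-increasing (top ρ)) (~-ext-std (ext ρ) k)

  beg-~ : ∀ π → ext π ~[ K ] ext (top (beg π))
  beg-~ π = ~-trans (ext π) (ext (beg π)) (ext (top (beg π))) (~-ext-std (ext π) K)
    (~-weaken (ext (beg π)) (ext (top (beg π))) (n≤1+n K) (~-ext-std (ext (beg π)) k))

  cyc : Perm k → Perm k → ℕ
  cyc π τ = ∑< (k + k) (occ τ (periodic π))

  -- Both sides count windows, once those meeting only a proper prefix of
  -- π, which are the same for beg π ⊕ 1, are cancelled.
  cyc-difference : ∀ π τ →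
    cyc π τ + (path τ (beg π) + ι (std idSeq k ≟ₚ τ)) ≡
    cyc (top (beg π)) τ + (ι (π ≟ₚ τ) + path τ (end π))
  cyc-difference π τ = trans (cong₂ _+_
      (trans (∑-periodic π τ) (cong₂ _+_ same (windows-end τ π))) (sym (windows-top τ (beg π))))
    (trans (+-assoc c a b) (trans (cong (c +_) (+-comm a b))
    (trans (sym (+-assoc c b a))
    (cong (_+ a) (sym (∑-periodic (top (beg π)) τ))))))
    where
    a b c : ℕ
    a = ι (π ≟ₚ τ) + path τ (end π)
    b = ∑< k (occ τ (ext (top (beg π))))
    c = ∑< k (occ τ (lead k (ext (top (beg π)))))
    -- A window starting at i < k reaches at most position k + K - 1, so it does not meet the last
    -- entry of π.
    same : ∑< k (occ τ (lead k (ext π))) ≡ c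
    same = ∑<-cong k λ i i<k → occ-cong τ (lead k (ext π)) (lead k (ext (top (beg π)))) i i
      (~-shift (lead k (ext π)) (lead k (ext (top (beg π)))) i
        (~-weaken (lead k (ext π)) (lead k (ext (top (beg π))))
          (subst (_≤ k + K) (sym (+-suc i K)) (+-monoˡ-≤ K i<k))
          (lead-~ k (ext π) (ext (top (beg π))) (beg-~ π))))

-- The edges outside the spanning tree

  -- The loop at the identity satisfies π = top (beg π) too, so it is left out along with the tree
  -- edges.
  offTree? : ∀ n → Decidable (λ π → π ≢ top (beg π) × π avoids ↘ n)
  offTree? n π = ¬? (π ≟ₚ top (beg π)) ×-dec (π avoids? ↘ n)

  offTree : ℕ → List (Perm k)
  offTree n = filter (offTree? n) (allPerms k)

  ∈-offTree : ∀ {n π} → π ≢ top (beg π) → π avoids ↘ n → π ∈ offTree n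
  ∈-offTree {n} {π} π≢ av = ∈-filter⁺ (offTree? n) (allPerms-complete π) (π≢ , av)

  offTree⁻ : ∀ {n π} → π ∈ offTree n → π ≢ top (beg π) × π avoids ↘ n
  offTree⁻ {n} π∈ = proj₂ (∈-filter⁻ (offTree? n) {xs = allPerms k} π∈)

  offTree-unique : ∀ n → List.Unique (offTree n)
  offTree-unique n = ListUnique.filter⁺ (offTree? n) (allPerms-unique k)

  top-avoids : ∀ {n ρ} → 2 ≤ n → ρ avoids ↘ n → top ρ avoids ↘ n
  top-avoids {ρ = ρ} = ext-avoids {l = k} {σ = ρ}

  beg-avoids : ∀ {n π} → π avoids ↘ n → beg π avoids ↘ n
  beg-avoids {n} {π} av = subst (_avoids ↘ n) (std-cong (shift 0 (ext π)) (ext π) (~-refl (ext π)))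
    (window-avoids {σ = π} {0} {K} (n≤1+n K) av)

  private
    onTree? : ∀ n → Decidable (λ π → π ≡ top (beg π) × π avoids ↘ n)
    onTree? n π = (π ≟ₚ top (beg π)) ×-dec (π avoids? ↘ n)

    top-injective : ∀ {ρ ρ′ : Perm K} → top ρ ≡ top ρ′ → ρ ≡ ρ′
    top-injective {ρ} {ρ′} eq = trans (sym (beg-top ρ)) (trans (cong beg eq) (beg-top ρ′))

    -- The map `top` is a bijection from the avoiding vertices to these edges, with inverse `beg`; n
    -- ≥ 2 ensures that ρ ⊕ 1 still avoids.
    length-onTree : ∀ n → 2 ≤ n → (ρs : List (Perm K)) (πs : List (Perm k)) →
      List.Unique ρs → List.Unique πs → (∀ ρ → ρ ∈ ρs) → (∀ π → π ∈ πs) →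
      length (filter (onTree? n) πs) ≡ length (filter (_avoids? ↘ n) ρs)
    length-onTree n 2≤n ρs πs uρ uπ all-ρ all-π = sym (length-bijection top top-injective
      (ListUnique.filter⁺ (_avoids? ↘ n) uρ) (ListUnique.filter⁺ (onTree? n) uπ)
      (λ {ρ} ρ∈ → ∈-filter⁺ (onTree? n) (all-π (top ρ))
        (sym (top-beg-top ρ) , top-avoids {ρ = ρ} 2≤n (proj₂ (∈-filter⁻ (_avoids? ↘ n) {xs = ρs} ρ∈))))
      (λ {π} π∈ → let (_ , eq , av) = ∈-filter⁻ (onTree? n) {xs = πs} π∈ in
        beg π , ∈-filter⁺ (_avoids? ↘ n) (all-ρ (beg π)) (beg-avoids {π = π} av) , eq))

    onTree-split : ∀ n (πs : List (Perm k)) →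
      length (filter (onTree? n) πs) + length (filter (offTree? n) πs) ≡ length (filter (_avoids? ↘ n) πs)
    onTree-split n = length-filter-split (λ π → π ≟ₚ top (beg π)) (_avoids? ↘ n)

  ∣Av∣-split : ∀ n → 2 ≤ n → ∣Av∣ K n + length (offTree n) ≡ ∣Av∣ k n
  ∣Av∣-split n 2≤n = trans (cong (_+ length (offTree n)) (sym (length-onTree n 2≤n (allPerms K) (allPerms k)
      (allPerms-unique K) (allPerms-unique k) allPerms-complete allPerms-complete)))
    (onTree-split n (allPerms k))

-- Rational arithmetic

# : ℕ → ℚ
# zero    = 0ℚ
# (suc n) = 1ℚ ℚ.+ # n

#-+ : ∀ a b → # (a + b) ≡ # a ℚ.+ # b
#-+ zero    b = sym (ℚ.+-identityˡ (# b))
#-+ (suc a) b = trans (cong (1ℚ ℚ.+_) (#-+ a b)) (sym (ℚ.+-assoc 1ℚ (# a) (# b)))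

#-* : ∀ a b → # (a * b) ≡ # a ℚ.* # b
#-* zero    b = sym (ℚ.*-zeroˡ (# b))
#-* (suc a) b = trans (#-+ b (a * b)) (trans (cong₂ ℚ._+_ (sym (ℚ.*-identityˡ (# b))) (#-* a b))
  (sym (ℚ.*-distribʳ-+ (# b) 1ℚ (# a))))

#-mono-≤ : ∀ {a b} → a ≤ b → # a ℚ.≤ # b
#-mono-≤ {b = zero}  z≤n     = ℚ.≤-refl
#-mono-≤ {b = suc b} z≤n     = ℚ.≤-trans (#-mono-≤ {b = b} z≤n)
  (subst (ℚ._≤ 1ℚ ℚ.+ # b) (ℚ.+-identityˡ (# b)) (ℚ.+-monoˡ-≤ (# b) (ℚ.<⇒≤ (ℚ.positive⁻¹ 1ℚ))))
#-mono-≤             (s≤s p) = ℚ.+-monoʳ-≤ 1ℚ (#-mono-≤ p)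

0≤# : ∀ n → 0ℚ ℚ.≤ # n
0≤# n = #-mono-≤ {b = n} z≤n

∣#∣ : ∀ n → ℚ.∣ # n ∣ ≡ # n
∣#∣ n = ℚ.0≤p⇒∣p∣≡p (0≤# n)

#0* : ∀ {n} q → n ≡ 0 → # n ℚ.* q ≡ 0ℚ
#0* q refl = ℚ.*-zeroˡ q

#1* : ∀ {n} q → n ≡ 1 → # n ℚ.* q ≡ q
#1* q refl = ℚ.*-identityˡ q

/-+ : ∀ a b m .{{_ : NonZero m}} → (ℤ.+ a ℚ./ m) ℚ.+ (ℤ.+ b ℚ./ m) ≡ ℤ.+ (a + b) ℚ./ m
/-+ a b (suc m) = ℚ.toℚᵘ-injective
  (ℚᵘ.≃-trans (ℚ.toℚᵘ-homo-+ (ℚ.fromℚᵘ p) (ℚ.fromℚᵘ q))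
  (ℚᵘ.≃-trans (ℚᵘ.+-cong {ℚ.toℚᵘ (ℚ.fromℚᵘ p)} {p} {ℚ.toℚᵘ (ℚ.fromℚᵘ q)} {q}
    (ℚ.toℚᵘ-fromℚᵘ p) (ℚ.toℚᵘ-fromℚᵘ q))
  (ℚᵘ.≃-trans {p ℚᵘ.+ q} {r} (ℚᵘ.*≡* (solve 3 (λ a b d →
      (a :* d :+ b :* d) :* d := (a :+ b) :* (d :* d)) refl (ℤ.+ a) (ℤ.+ b) (ℤ.+ suc m)))
  (ℚᵘ.≃-sym (ℚ.toℚᵘ-fromℚᵘ r)))))
  where
  open ℤ.+-*-Solver
  p q r : ℚᵘ.ℚᵘ
  p = ℚᵘ.mkℚᵘ (ℤ.+ a) m
  q = ℚᵘ.mkℚᵘ (ℤ.+ b) m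
  r = ℚᵘ.mkℚᵘ (ℤ.+ (a + b)) m

u : ∀ m .{{_ : NonZero m}} → ℚ
u m = ℤ.+ 1 ℚ./ m

-- In this form the ring solver can treat 1/m as an atom.
/≡#*u : ∀ c m .{{_ : NonZero m}} → ℤ.+ c ℚ./ m ≡ # c ℚ.* u m
/≡#*u zero    m = trans (ℚ.0/n≡0 m) (sym (ℚ.*-zeroˡ (u m)))
/≡#*u (suc c) m = trans (sym (/-+ 1 c m)) (trans (cong₂ ℚ._+_ (sym (ℚ.*-identityˡ (u m))) (/≡#*u c m))
  (sym (ℚ.*-distribʳ-+ (u m) 1ℚ (# c))))

#*u≡1 : ∀ m .{{_ : NonZero m}} → # m ℚ.* u m ≡ 1ℚ
#*u≡1 m = trans (sym (/≡#*u m m)) (m/m≡1 m)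
  where
  m/m≡1 : ∀ m .{{_ : NonZero m}} → ℤ.+ m ℚ./ m ≡ 1ℚ
  m/m≡1 (suc m) = ℚ.toℚᵘ-injective (ℚᵘ.≃-trans (ℚ.toℚᵘ-fromℚᵘ (ℚᵘ.mkℚᵘ (ℤ.+ suc m) m))
    (ℚᵘ.*≡* (solve 1 (λ d → d :* con (ℤ.+ 1) := con (ℤ.+ 1) :* d) refl (ℤ.+ suc m))))
    where
    open ℤ.+-*-Solver

u-nonNeg : ∀ m .{{_ : NonZero m}} → ℚ.NonNegative (u m)
u-nonNeg m = ℚ.normalize-nonNeg 1 m

∣u*∣ : ∀ m .{{_ : NonZero m}} p → ℚ.∣ u m ℚ.* p ∣ ≡ u m ℚ.* ℚ.∣ p ∣
∣u*∣ m p = trans (ℚ.∣p*q∣≡∣p∣*∣q∣ (u m) p)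
  (cong (ℚ._* ℚ.∣ p ∣) (ℚ.0≤p⇒∣p∣≡p (ℚ.nonNegative⁻¹ (u m) {{u-nonNeg m}})))

u*-mono-≤ : ∀ m .{{_ : NonZero m}} {p q} → p ℚ.≤ q → u m ℚ.* p ℚ.≤ u m ℚ.* q
u*-mono-≤ m = ℚ.*-monoˡ-≤-nonNeg (u m) {{u-nonNeg m}}

-- A positive rational (p + 1)/(d + 1) is at least 1/(d + 1).
u≤pos : ∀ ε → 0ℚ ℚ.< ε → ∃[ d ] Σ (NonZero d) λ nz → u d {{nz}} ℚ.≤ ε
u≤pos ε@(mkℚ (ℤ.+ suc p) d _) _ = suc d , _ ,
  subst₂ ℚ._≤_ (ℚ.*-identityʳ (u (suc d)))
    (trans (ℚ.*-comm (u (suc d)) (# (suc p))) (trans (sym (/≡#*u (suc p) (suc d))) (ℚ.↥p/↧p≡p ε)))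
    (u*-mono-≤ (suc d) (#-mono-≤ {1} {suc p} (s≤s z≤n)))
u≤pos (mkℚ (ℤ.+ 0) d _) (ℚ.*<* (ℤ.+<+ ()))
u≤pos (mkℚ ℤ.-[1+ _ ] d _) (ℚ.*<* ())

-- Boundary effects in a permutation of size m contribute at most C/m for a constant C; this makes
-- them negligible.
u*#-small : ∀ C ε → 0ℚ ℚ.< ε → ∃[ B ] ∀ m .{{_ : NonZero m}} → B ≤ m → u m ℚ.* # C ℚ.≤ ε
u*#-small C ε 0<ε with u≤pos ε 0<ε
... | d , nz , ud≤ε = C * d , λ m C*d≤m → ℚ.≤-trans (bound m C*d≤m) ud≤ε
  where
  instance
    _ = nz
  -- C/m = (Cd)/(md) ≤ m/(md) = 1/d
  bound : ∀ m .{{_ : NonZero m}} → C * d ≤ m → u m ℚ.* # C ℚ.≤ u d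
  bound m C*d≤m = subst₂ ℚ._≤_ left right
    (u*-mono-≤ m (ℚ.*-monoʳ-≤-nonNeg (u d) {{u-nonNeg d}} (#-mono-≤ C*d≤m)))
    where
    left : u m ℚ.* (# (C * d) ℚ.* u d) ≡ u m ℚ.* # C
    left = cong (u m ℚ.*_) (trans (cong (ℚ._* u d) (#-* C d)) (trans (ℚ.*-assoc (# C) (# d) (u d))
      (trans (cong (# C ℚ.*_) (#*u≡1 d)) (ℚ.*-identityʳ (# C)))))
    right : u m ℚ.* (# m ℚ.* u d) ≡ u d
    right = trans (sym (ℚ.*-assoc (u m) (# m) (u d)))
      (trans (cong (ℚ._* u d) (trans (ℚ.*-comm (u m) (# m)) (#*u≡1 m))) (ℚ.*-identityˡ (u d)))

-- Null sequences

½-pos : ∀ {ε} → 0ℚ ℚ.< ε → 0ℚ ℚ.< ε ℚ.* ℚ.½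
½-pos {ε} 0<ε = subst (ℚ._< ε ℚ.* ℚ.½) (ℚ.*-zeroˡ ℚ.½) (ℚ.*-monoˡ-<-pos ℚ.½ 0<ε)

½+½ : ∀ ε → ε ℚ.* ℚ.½ ℚ.+ ε ℚ.* ℚ.½ ≡ ε
½+½ ε = trans (sym (ℚ.*-distribˡ-+ ε ℚ.½ ℚ.½)) (ℚ.*-identityʳ ε)

∣+∣-≤ : ∀ {a b c d} → ℚ.∣ a ∣ ℚ.≤ c → ℚ.∣ b ∣ ℚ.≤ d → ℚ.∣ a ℚ.+ b ∣ ℚ.≤ c ℚ.+ d
∣+∣-≤ {a} {b} p q = ℚ.≤-trans (ℚ.∣p+q∣≤∣p∣+∣q∣ a b) (ℚ.+-mono-≤ p q)

∣+∣-½ : ∀ {a b} ε → ℚ.∣ a ∣ ℚ.≤ ε ℚ.* ℚ.½ → ℚ.∣ b ∣ ℚ.≤ ε ℚ.* ℚ.½ → ℚ.∣ a ℚ.+ b ∣ ℚ.≤ ε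
∣+∣-½ {a} {b} ε p q = subst (ℚ.∣ a ℚ.+ b ∣ ℚ.≤_) (½+½ ε) (∣+∣-≤ {a} {b} p q)

scale : ∀ B ε → 0ℚ ℚ.< B → 0ℚ ℚ.< ε → ∃[ δ ] 0ℚ ℚ.< δ ×
  (∀ {a b} → ℚ.∣ a ∣ ℚ.≤ B → ℚ.∣ b ∣ ℚ.≤ δ → ℚ.∣ a ℚ.* b ∣ ℚ.≤ ε)
scale B ε 0<B 0<ε = δ , 0<δ , λ {a} {b} a≤B b≤δ → subst₂ ℚ._≤_ (sym (ℚ.∣p*q∣≡∣p∣*∣q∣ a b)) Bδ≡ε
    (ℚ.≤-trans (ℚ.*-monoʳ-≤-nonNeg ℚ.∣ b ∣ {{ℚ.nonNegative (ℚ.0≤∣p∣ b)}} a≤B)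
               (ℚ.*-monoˡ-≤-nonNeg B {{ℚ.nonNegative (ℚ.<⇒≤ 0<B)}} b≤δ))
  where
  instance
    B-pos : ℚ.Positive B
    B-pos = ℚ.positive 0<B
    B-nonZero : ℚ.NonZero B
    B-nonZero = ℚ.pos⇒nonZero B
  δ : ℚ
  δ = ε ℚ.* ℚ.1/ B
  0<δ : 0ℚ ℚ.< δ
  0<δ = subst (ℚ._< δ) (ℚ.*-zeroˡ (ℚ.1/ B)) (ℚ.*-monoˡ-<-pos (ℚ.1/ B) {{ℚ.1/pos⇒pos B}} 0<ε)
  Bδ≡ε : B ℚ.* δ ≡ ε
  Bδ≡ε = trans (ℚ.*-comm B δ) (trans (ℚ.*-assoc ε (ℚ.1/ B) B)
    (trans (cong (ε ℚ.*_) (ℚ.*-inverseˡ B)) (ℚ.*-identityʳ ε)))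

-- `x ≈ℝ y` unfolds to `Null` of the termwise difference, so facts about null sequences apply
-- directly to equality of reals.
Null : (ℕ → ℚ) → Set
Null s = ∀ ε → 0ℚ ℚ.< ε → ∃[ N ] ∀ i → N ≤ i → ℚ.∣ s i ∣ ℚ.≤ ε

Bounded : (ℕ → ℚ) → Set
Bounded s = ∃[ B ] 0ℚ ℚ.< B × ∃[ N ] ∀ i → N ≤ i → ℚ.∣ s i ∣ ℚ.≤ B

null-cong : ∀ {s t} → (∀ i → s i ≡ t i) → Null s → Null t
null-cong eq null ε 0<ε = let (N , p) = null ε 0<ε in
  N , λ i N≤i → subst (λ x → ℚ.∣ x ∣ ℚ.≤ ε) (eq i) (p i N≤i)

null-0 : Null (λ _ → 0ℚ)
null-0 ε 0<ε = 0 , λ _ _ → ℚ.<⇒≤ 0<ε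

null-+ : ∀ {s t} → Null s → Null t → Null (λ i → s i ℚ.+ t i)
null-+ {s} {t} p q ε 0<ε =
  let (M , p′) = p (ε ℚ.* ℚ.½) (½-pos 0<ε)
      (N , q′) = q (ε ℚ.* ℚ.½) (½-pos 0<ε)
  in M ⊔ N , λ i ≤i → ∣+∣-½ {s i} {t i} ε (p′ i (m⊔n≤o⇒m≤o M N ≤i)) (q′ i (m⊔n≤o⇒n≤o M N ≤i))

null-* : ∀ {b s} → Bounded b → Null s → Null (λ i → b i ℚ.* s i)
null-* {b} {s} (B , 0<B , M , b≤B) p ε 0<ε =
  let (δ , 0<δ , bound) = scale B ε 0<B 0<ε
      (N , p′) = p δ 0<δ
  in M ⊔ N , λ i ≤i → bound {b i} {s i} (b≤B i (m⊔n≤o⇒m≤o M N ≤i)) (p′ i (m⊔n≤o⇒n≤o M N ≤i))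

private
  0<1+∣_∣ : ∀ q → 0ℚ ℚ.< 1ℚ ℚ.+ ℚ.∣ q ∣
  0<1+∣ q ∣ = ℚ.<-≤-trans (ℚ.positive⁻¹ 1ℚ)
    (subst (ℚ._≤ 1ℚ ℚ.+ ℚ.∣ q ∣) (ℚ.+-identityʳ 1ℚ) (ℚ.+-monoʳ-≤ 1ℚ (ℚ.0≤∣p∣ q)))

  ∣_∣≤1+ : ∀ q → ℚ.∣ q ∣ ℚ.≤ 1ℚ ℚ.+ ℚ.∣ q ∣
  ∣ q ∣≤1+ = subst (ℚ._≤ 1ℚ ℚ.+ ℚ.∣ q ∣) (ℚ.+-identityˡ ℚ.∣ q ∣)
    (ℚ.+-monoˡ-≤ ℚ.∣ q ∣ (ℚ.<⇒≤ (ℚ.positive⁻¹ 1ℚ)))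

const-bounded : ∀ q → Bounded (λ _ → q)
const-bounded q = 1ℚ ℚ.+ ℚ.∣ q ∣ , 0<1+∣ q ∣ , 0 , λ _ _ → ∣ q ∣≤1+

real-bounded : ∀ x → Bounded (seq x)
real-bounded x with cauchy x 1ℚ (ℚ.positive⁻¹ 1ℚ)
... | N , close = 1ℚ ℚ.+ ℚ.∣ seq x N ∣ , 0<1+∣ seq x N ∣ , N , λ i N≤i →
  subst (λ z → ℚ.∣ z ∣ ℚ.≤ 1ℚ ℚ.+ ℚ.∣ seq x N ∣)
    (solve 2 (λ a b → (a :- b) :+ b := a) refl (seq x i) (seq x N))
    (∣+∣-≤ {seq x i ℚ.- seq x N} {seq x N} (close i N N≤i ≤-refl) ℚ.≤-refl)
  where
  open +-*-Solver

-- The rationals q(i) converge to the real represented by the sequence r.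
Converges : (ℕ → ℚ) → (ℕ → ℚ) → Set
Converges q r = ∀ ε → 0ℚ ℚ.< ε →
  ∃[ N ] ∀ i → N ≤ i → ∃[ M ] ∀ t → M ≤ t → ℚ.∣ q i ℚ.- r t ∣ ℚ.≤ ε

-- The comparison `_≤ℝ_` inside the limit has an error of its own, so each of the two gets half of
-- ε.
⟶⇒converges : ∀ (q : ℕ → ℚ) x → (λ i → fromℚ (q i)) ⟶ x → Converges q (seq x)
⟶⇒converges q x lim ε 0<ε with lim (ε ℚ.* ℚ.½) (½-pos 0<ε)
... | N , p = N , λ i N≤i → let (M , p′) = p i N≤i (ε ℚ.* ℚ.½) (½-pos 0<ε) in
  M , λ t M≤t → subst (ℚ.∣ q i ℚ.- seq x t ∣ ℚ.≤_) (½+½ ε) (p′ t M≤t)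

converges-+ : ∀ {q r q′ r′} → Converges q r → Converges q′ r′ →
  Converges (λ i → q i ℚ.+ q′ i) (λ t → r t ℚ.+ r′ t)
converges-+ {q} {r} {q′} {r′} c c′ ε 0<ε =
  let (N , p) = c (ε ℚ.* ℚ.½) (½-pos 0<ε)
      (N′ , p′) = c′ (ε ℚ.* ℚ.½) (½-pos 0<ε)
  in N ⊔ N′ , λ i ≤i →
    let (M , b) = p i (m⊔n≤o⇒m≤o N N′ ≤i)
        (M′ , b′) = p′ i (m⊔n≤o⇒n≤o N N′ ≤i)
    in M ⊔ M′ , λ t ≤t → subst (λ z → ℚ.∣ z ∣ ℚ.≤ ε)
      (solve 4 (λ a b c d → (a :- b) :+ (c :- d) := (a :+ c) :- (b :+ d)) refl (q i) (r t) (q′ i) (r′ t))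
      (∣+∣-½ {q i ℚ.- r t} {q′ i ℚ.- r′ t} ε (b t (m⊔n≤o⇒m≤o M M′ ≤t)) (b′ t (m⊔n≤o⇒n≤o M M′ ≤t)))
  where
  open +-*-Solver

converges-* : ∀ c {q r} → Converges q r → Converges (λ i → q i ℚ.* c) (λ t → r t ℚ.* c)
converges-* c {q} {r} conv ε 0<ε =
  let (δ , 0<δ , bound) = scale (1ℚ ℚ.+ ℚ.∣ c ∣) ε 0<1+∣ c ∣ 0<ε
      (N , p) = conv δ 0<δ
  in N , λ i N≤i → let (M , b) = p i N≤i in M , λ t M≤t →
    subst (λ z → ℚ.∣ z ∣ ℚ.≤ ε)
      (solve 3 (λ a b c → c :* (a :- b) := a :* c :- b :* c) refl (q i) (r t) c)
      (bound {c} {q i ℚ.- r t} ∣ c ∣≤1+ (b t M≤t))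
  where
  open +-*-Solver

converges-neg : ∀ {q r} → Converges q r → Converges (λ i → ℚ.- q i) (λ t → ℚ.- r t)
converges-neg {q} {r} conv ε 0<ε =
  let (N , p) = conv ε 0<ε
  in N , λ i N≤i → let (M , b) = p i N≤i in M , λ t M≤t →
    subst (ℚ._≤ ε) (trans (sym (ℚ.∣-p∣≡∣p∣ (q i ℚ.- r t)))
      (cong ℚ.∣_∣ (solve 2 (λ a b → :- (a :- b) := (:- a) :- (:- b)) refl (q i) (r t)))) (b t M≤t)
  where
  open +-*-Solver

-- A single index i beyond both bounds suffices: q i is within ε/2 of c, and of r t for all large t.
converges-unique : ∀ {q r} c → Converges q r → Null (λ i → q i ℚ.- c) → Null (λ t → r t ℚ.- c)
converges-unique {q} {r} c conv null ε 0<ε =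
  let (N , p) = conv (ε ℚ.* ℚ.½) (½-pos 0<ε)
      (N′ , p′) = null (ε ℚ.* ℚ.½) (½-pos 0<ε)
      i = N ⊔ N′
      (M , b) = p i (m≤m⊔n N N′)
  in M , λ t M≤t → subst (λ z → ℚ.∣ z ∣ ℚ.≤ ε)
    (solve 3 (λ a b c → :- (a :- b) :+ (a :- c) := b :- c) refl (q i) (r t) c)
    (∣+∣-½ {ℚ.- (q i ℚ.- r t)} {q i ℚ.- c} ε
      (subst (ℚ._≤ ε ℚ.* ℚ.½) (sym (ℚ.∣-p∣≡∣p∣ (q i ℚ.- r t))) (b t M≤t)) (p′ i (m≤n⊔m N N′)))
  where
  open +-*-Solver

-- Finite sums of rationals and reals

open SemiringSum (CommutativeRing.semiring ℚ.+-*-commutativeRing) public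
  using (sum; sum-cong-≗; ∑-distrib-+; *-distribˡ-sum; *-distribʳ-sum)

sum-zero : ∀ {n} (f : Fin n → ℚ) → (∀ i → f i ≡ 0ℚ) → sum f ≡ 0ℚ
sum-zero {zero}  f eq = refl
sum-zero {suc n} f eq = trans (cong₂ ℚ._+_ (eq zero) (sum-zero (f ∘ suc) (eq ∘ suc))) (ℚ.+-identityˡ 0ℚ)

sum-unique : ∀ {n} (f : Fin n → ℚ) j → (∀ i → i ≢ j → f i ≡ 0ℚ) → sum f ≡ f j
sum-unique f zero    eq = trans (cong (f zero ℚ.+_) (sum-zero (f ∘ suc) λ i → eq (suc i) λ ())) (ℚ.+-identityʳ _)
sum-unique f (suc j) eq = trans (cong₂ ℚ._+_ (eq zero λ ())
  (sum-unique (f ∘ suc) j λ i i≢j → eq (suc i) λ { refl → i≢j refl })) (ℚ.+-identityˡ _)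

seq-sumℝ : ∀ {n} (f : Fin n → ℝ) t → seq (sumℝ f) t ≡ sum (λ i → seq (f i) t)
seq-sumℝ {zero}  f t = refl
seq-sumℝ {suc n} f t = cong (seq (f zero) t ℚ.+_) (seq-sumℝ (f ∘ suc) t)

null-sum : ∀ {n} (f : Fin n → ℕ → ℚ) → (∀ i → Null (f i)) → Null (λ t → sum (λ i → f i t))
null-sum {zero}  f null = null-0
null-sum {suc n} f null = null-+ (null zero) (null-sum (f ∘ suc) (null ∘ suc))

converges-sum : ∀ {n} (q r : Fin n → ℕ → ℚ) → (∀ j → Converges (q j) (r j)) →
  Converges (λ i → sum (λ j → q j i)) (λ t → sum (λ j → r j t))
converges-sum {zero}  q r conv = λ ε 0<ε → 0 , λ _ _ → 0 , λ _ _ → ℚ.<⇒≤ 0<ε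
converges-sum {suc n} q r conv = converges-+ {q zero} {r zero} (conv zero)
  (converges-sum (q ∘ suc) (r ∘ suc) (conv ∘ suc))

open import Data.Integer.Base using (+_; _-_)

lookup-injective : ∀ {A : Set} {xs : List A} → List.Unique xs →
  ∀ i j → List.lookup xs i ≡ List.lookup xs j → i ≡ j
lookup-injective (_ ∷ _)  zero    zero    _  = refl
lookup-injective (x∉ ∷ _) zero    (suc j) eq = contradiction eq (All.lookup x∉ (∈-lookup j))
lookup-injective (x∉ ∷ _) (suc i) zero    eq = contradiction (sym eq) (All.lookup x∉ (∈-lookup i))
lookup-injective (_ ∷ u)  (suc i) (suc j) eq = cong suc (lookup-injective u i j eq)

-- Affine hulls

≡⇒≈ℝ : ∀ {x y} → (∀ t → seq x t ≡ seq y t) → x ≈ℝ y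
≡⇒≈ℝ {x} {y} eq = null-cong (λ t → sym (trans (cong (ℚ._- seq y t) (eq t)) (ℚ.+-inverseʳ (seq y t)))) null-0

≈ℝ-trans : ∀ x y z → x ≈ℝ y → y ≈ℝ z → x ≈ℝ z
≈ℝ-trans x y z p q = null-cong (λ t → telescope (seq x t) (seq y t) (seq z t)) (null-+ p q)
  where
  open +-*-Solver
  telescope : ∀ a b c → (a ℚ.- b) ℚ.+ (b ℚ.- c) ≡ a ℚ.- c
  telescope = solve 3 (λ a b c → (a :- b) :+ (b :- c) := a :- c) refl

seq-linComb : ∀ {k r} (c : Fin r → ℝ) (p : Fin r → Point k) π t →
  seq (linComb c p π) t ≡ sum (λ i → seq (c i) t ℚ.* seq (p i π) t)
seq-linComb c p π t = seq-sumℝ (λ i → c i *ℝ p i π) t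

module _ {k : ℕ} (A : Pred (Point k) 0ℓ) where

  hull-resp : ∀ {x y} → x ≈ₚ y → AffineHull A y → AffineHull A x
  hull-resp {x} {y} x≈y (r , p , c , Ap , ∑c , y≈) = r , p , c , Ap , ∑c , λ π →
    ≈ℝ-trans (x π) (y π) (linComb c p π) (x≈y π) (y≈ π)

  hull-point : ∀ {x} → A x → AffineHull A x
  hull-point {x} Ax = 1 , (λ _ → x) , (λ _ → 1ℝ) , (λ _ → Ax) ,
    ≡⇒≈ℝ {sumℝ {1} (λ _ → 1ℝ)} {1ℝ} (λ _ → refl) ,
    λ π → ≡⇒≈ℝ {x π} {linComb {r = 1} (λ _ → 1ℝ) (λ _ → x) π} λ t →
      sym (trans (ℚ.+-identityʳ (1ℚ ℚ.* seq (x π) t)) (ℚ.*-identityˡ (seq (x π) t)))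

  -- The two new weights c and -c cancel, so the weights still sum to 1.
  hull-extend : ∀ {x a b} (c : ℝ) → AffineHull A x → A a → A b →
    AffineHull A (λ π → x π +ℝ c *ℝ (a π -ℝ b π))
  hull-extend {x} {a} {b} c (r , p , d , Ap , ∑d , x≈) Aa Ab =
    suc (suc r) , p′ , d′ , Ap′ ,
    null-cong (λ t → weights (seq c t) (seq (sumℝ d) t)) ∑d ,
    λ π → null-cong (λ t → trans
      (points (seq c t) (seq (a π) t) (seq (b π) t) (seq (x π) t) (seq (linComb d p π) t))
      (cong (λ l → (seq (x π) t ℚ.+ seq c t ℚ.* (seq (a π) t ℚ.- seq (b π) t)) ℚ.- l) (sym (combination π t)))) (x≈ π)
    where
    open +-*-Solver
    weights : ∀ c s → s ℚ.- 1ℚ ≡ (c ℚ.+ (ℚ.- c ℚ.+ s)) ℚ.- 1ℚ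
    weights = solve 2 (λ c s → s :- con 1ℚ := (c :+ (:- c :+ s)) :- con 1ℚ) refl
    points : ∀ c a b x l → x ℚ.- l ≡ (x ℚ.+ c ℚ.* (a ℚ.- b)) ℚ.- (c ℚ.* a ℚ.+ ((ℚ.- c) ℚ.* b ℚ.+ l))
    points = solve 5 (λ c a b x l →
      x :- l := (x :+ c :* (a :- b)) :- (c :* a :+ ((:- c) :* b :+ l))) refl
    p′ : Fin (suc (suc r)) → Point k
    p′ zero          = a
    p′ (suc zero)    = b
    p′ (suc (suc i)) = p i
    d′ : Fin (suc (suc r)) → ℝ
    d′ zero          = c
    d′ (suc zero)    = -ℝ c
    d′ (suc (suc i)) = d i
    Ap′ : ∀ i → A (p′ i)
    Ap′ zero          = Aa
    Ap′ (suc zero)    = Ab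
    Ap′ (suc (suc i)) = Ap i
    combination : ∀ π t → seq (linComb d′ p′ π) t ≡
      seq c t ℚ.* seq (a π) t ℚ.+ ((ℚ.- seq c t) ℚ.* seq (b π) t ℚ.+ seq (linComb d p π) t)
    combination π t = trans (seq-linComb d′ p′ π t)
      (cong (λ l → seq c t ℚ.* seq (a π) t ℚ.+ ((ℚ.- seq c t) ℚ.* seq (b π) t ℚ.+ l))
        (sym (seq-linComb d p π t)))

  hull-differences : ∀ {r x} (c : Fin r → ℝ) (a b : Fin r → Point k) → A x →
    (∀ j → A (a j)) → (∀ j → A (b j)) →
    AffineHull A (λ π → x π +ℝ sumℝ (λ j → c j *ℝ (a j π -ℝ b j π)))
  hull-differences {zero} {x} c a b Ax Aa Ab =
    hull-resp {λ π → x π +ℝ 0ℝ} {x}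
      (λ π → ≡⇒≈ℝ {x π +ℝ 0ℝ} {x π} λ t → ℚ.+-identityʳ (seq (x π) t)) (hull-point Ax)
  hull-differences {suc r} {x} c a b Ax Aa Ab =
    hull-resp {λ π → x π +ℝ sumℝ (difference π)} {λ π → rest π +ℝ difference π zero}
      (λ π → ≡⇒≈ℝ {x π +ℝ sumℝ (difference π)} {rest π +ℝ difference π zero} λ t → trans
        (cong (seq (x π) t ℚ.+_) (seq-sumℝ (difference π) t))
        (trans (swap (seq (x π) t) (term zero π t) (sum (λ j → term (suc j) π t)))
        (cong (λ s → (seq (x π) t ℚ.+ s) ℚ.+ term zero π t)
          (sym (seq-sumℝ (λ j → difference π (suc j)) t)))))
      (hull-extend {rest} {a zero} {b zero} (c zero) (hull-differences (c ∘ suc) (a ∘ suc) (b ∘ suc) Ax (Aa ∘ suc) (Ab ∘ suc))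
        (Aa zero) (Ab zero))
    where
    open +-*-Solver
    difference : Perm k → Fin (suc r) → ℝ
    difference π j = c j *ℝ (a j π -ℝ b j π)
    rest : Point k
    rest π = x π +ℝ sumℝ (λ j → difference π (suc j))
    term : Fin (suc r) → Perm k → ℕ → ℚ
    term j π t = seq (c j) t ℚ.* (seq (a j π) t ℚ.- seq (b j π) t)
    swap : ∀ x y s → x ℚ.+ (y ℚ.+ s) ≡ (x ℚ.+ s) ℚ.+ y
    swap = solve 3 (λ x y s → x :+ (y :+ s) := (x :+ s) :+ y) refl

module _ {n K : ℕ} (2≤n : 2 ≤ n) where

  private
    k : ℕ
    k = suc K

-- Points of the feasible region

  -- If the windows of `s` repeat with period `P`, these are the limiting pattern frequencies of its
  -- prefixes.
  frequency : Seq → ∀ P .{{_ : NonZero P}} → Point k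
  frequency s P τ = fromℚ (+ ∑< P (occ τ s) ℚ./ P)

  -- Only windows starting at one of the last K positions are affected by
  -- cutting off the sequence.
  c-occ-prefix : ∀ s m (τ : Perm k) → ∃[ r ] r ≤ K × c-occ τ (std s m) + r ≡ ∑< m (occ τ s)
  c-occ-prefix s m τ = ∑< (m ∸ M) f , bound , trans
      (cong (_+ ∑< (m ∸ M) f) (trans (c-occ≡∑ τ (std s m)) (∑<-cong M λ i i<M →
        occ-cong τ (ext (std s m)) s i i (~-shift (ext (std s m)) s i
          (~-weaken (ext (std s m)) s (window-fits i<M) (ext-std-~ s m))))))
      (trans (sym (∑<-split M (m ∸ M) (occ τ s))) (cong (λ l → ∑< l (occ τ s)) (m+[n∸m]≡n (m∸n≤m m K))))
    where
    M : ℕ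
    M = m ∸ K
    f : ℕ → ℕ
    f i = occ τ s (M + i)
    bound : ∑< (m ∸ M) f ≤ K
    bound = ≤-trans (∑<-mono-≤ (m ∸ M) λ i _ → occ≤1 τ s (M + i))
      (≤-trans (≤-reflexive (trans (∑<-const (m ∸ M) 1) (*-identityʳ (m ∸ M)))) (m∸[m∸n]≤n m K))

  -- The prefixes of length (N + 1)P converge to it: they contain N + 1 periods up to at most K
  -- cut-off windows. Taking `suc N` periods keeps the sizes nonzero.
  frequency-feasible : ∀ s P .{{_ : NonZero P}} → (∀ i → shift (P + i) s ~[ k ] shift i s) →
    (∀ l → std s l avoids ↘ n) → FeasibleRegion n k (frequency s P)
  frequency-feasible s P per av = range , σ ,
    (λ B → B , λ N B≤N → ≤-trans B≤N (≤-trans (n≤1+n N) (m≤m*n (suc N) P))) ,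
    λ τ ε 0<ε → let (B , small) = u*#-small K ε 0<ε in
      B , λ N B≤N ε′ 0<ε′ → 0 , λ _ _ → ℚ.≤-trans
        (ℚ.≤-trans (close N τ) (small (suc N * P) {{nz N}}
          (≤-trans B≤N (≤-trans (n≤1+n N) (m≤m*n (suc N) P)))))
        (subst (ℚ._≤ ε ℚ.+ ε′) (ℚ.+-identityʳ ε) (ℚ.+-monoʳ-≤ ε (ℚ.<⇒≤ 0<ε′)))
    where
    Z : Perm k → ℕ
    Z τ = ∑< P (occ τ s)
    z : Perm k → ℚ
    z τ = + Z τ ℚ./ P
    nz : ∀ N → NonZero (suc N * P)
    nz N = m*n≢0 (suc N) P
    σ : ℕ → AvPerm n
    σ N = record { size = suc N * P ; nonEmpty = nz N ; perm = std s (suc N * P) ; avoiding = av (suc N * P) }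
    0≤ε : ∀ {p q} ε → 0ℚ ℚ.< ε → p ℚ.≤ q → p ℚ.≤ q ℚ.+ ε
    0≤ε {p} {q} ε 0<ε p≤q = ℚ.≤-trans p≤q (subst (ℚ._≤ q ℚ.+ ε) (ℚ.+-identityʳ q) (ℚ.+-monoʳ-≤ q (ℚ.<⇒≤ 0<ε)))
    0≤z : ∀ τ → 0ℚ ℚ.≤ z τ
    0≤z τ = subst₂ ℚ._≤_ (ℚ.*-zeroˡ (u P)) (sym (/≡#*u (Z τ) P))
      (ℚ.*-monoʳ-≤-nonNeg (u P) {{u-nonNeg P}} (0≤# (Z τ)))
    z≤1 : ∀ τ → z τ ℚ.≤ 1ℚ
    z≤1 τ = subst₂ ℚ._≤_ (sym (/≡#*u (Z τ) P)) (#*u≡1 P)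
      (ℚ.*-monoʳ-≤-nonNeg (u P) {{u-nonNeg P}} (#-mono-≤ (subst (Z τ ≤_)
        (trans (∑<-const P 1) (*-identityʳ P)) (∑<-mono-≤ P λ i _ → occ≤1 τ s i))))
    range : ∀ τ → 0ℝ ≤ℝ frequency s P τ × frequency s P τ ≤ℝ 1ℝ
    range τ = (λ ε 0<ε → 0 , λ _ _ → 0≤ε {0ℚ} {z τ} ε 0<ε (0≤z τ)) ,
              (λ ε 0<ε → 0 , λ _ _ → 0≤ε {z τ} {1ℚ} ε 0<ε (z≤1 τ))
    -- With C + r = (N + 1) Z, the difference C / ((N + 1) P) - Z / P is
    -- -r / ((N + 1) P).
    close : ∀ N τ → ℚ.∣ c-occ~ {{nz N}} τ (std s (suc N * P)) ℚ.- z τ ∣ ℚ.≤ u (suc N * P) {{nz N}} ℚ.* # K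
    close N τ = subst (ℚ._≤ u m ℚ.* # K)
      (sym (trans (cong ℚ.∣_∣ difference) (trans (∣u*∣ m (ℚ.- # r))
        (cong (u m ℚ.*_) (trans (ℚ.∣-p∣≡∣p∣ (# r)) (∣#∣ r))))))
      (u*-mono-≤ m (#-mono-≤ r≤K))
      where
      m : ℕ
      m = suc N * P
      instance
        _ = nz N
      prefix = c-occ-prefix s m τ
      r : ℕ
      r = proj₁ prefix
      r≤K : r ≤ K
      r≤K = proj₁ (proj₂ prefix)
      C : ℕ
      C = c-occ τ (std s m)
      C+r : # C ℚ.+ # r ≡ # (suc N) ℚ.* # (Z τ)
      C+r = trans (sym (#-+ C r)) (trans (cong # (trans (proj₂ (proj₂ prefix))
        (∑<-periodic P (occ τ s) (λ i → occ-cong τ s s (P + i) i (per i)) (suc N)))) (#-* (suc N) (Z τ)))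
      uP : u P ≡ u m ℚ.* # (suc N)
      uP = begin
        u P                                     ≡⟨ ℚ.*-identityˡ (u P) ⟨
        1ℚ ℚ.* u P                              ≡⟨ cong (ℚ._* u P) (#*u≡1 m) ⟨
        (# m ℚ.* u m) ℚ.* u P                   ≡⟨ cong (λ x → (x ℚ.* u m) ℚ.* u P) (#-* (suc N) P) ⟩
        ((# (suc N) ℚ.* # P) ℚ.* u m) ℚ.* u P
          ≡⟨ solve 4 (λ a b c d → ((a :* b) :* c) :* d := (c :* a) :* (b :* d)) refl
               (# (suc N)) (# P) (u m) (u P) ⟩
        (u m ℚ.* # (suc N)) ℚ.* (# P ℚ.* u P)   ≡⟨ cong ((u m ℚ.* # (suc N)) ℚ.*_) (#*u≡1 P) ⟩
        (u m ℚ.* # (suc N)) ℚ.* 1ℚ              ≡⟨ ℚ.*-identityʳ _ ⟩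
        u m ℚ.* # (suc N)                       ∎
        where
        open ≡-Reasoning
        open +-*-Solver
      difference : c-occ~ τ (std s m) ℚ.- z τ ≡ u m ℚ.* (ℚ.- # r)
      difference = begin
        c-occ~ τ (std s m) ℚ.- z τ
          ≡⟨ cong₂ ℚ._-_ (/≡#*u C m) (trans (/≡#*u (Z τ) P) (cong (# (Z τ) ℚ.*_) uP)) ⟩
        # C ℚ.* u m ℚ.- # (Z τ) ℚ.* (u m ℚ.* # (suc N))
          ≡⟨ solve 4 (λ c z u n → c :* u :- z :* (u :* n) := u :* (c :- n :* z)) refl (# C) (# (Z τ)) (u m) (# (suc N)) ⟩
        u m ℚ.* (# C ℚ.- # (suc N) ℚ.* # (Z τ))
          ≡⟨ cong (λ x → u m ℚ.* (# C ℚ.- x)) C+r ⟨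
        u m ℚ.* (# C ℚ.- (# C ℚ.+ # r))
          ≡⟨ cong (u m ℚ.*_) (solve 2 (λ c r → c :- (c :+ r) := :- r) refl (# C) (# r)) ⟩
        u m ℚ.* (ℚ.- # r) ∎
        where
        open ≡-Reasoning
        open +-*-Solver

-- The fundamental cycles

  δ : Perm k → ℚ
  δ τ = # (ι (std idSeq k ≟ₚ τ))

  E : Perm k → Perm k → ℚ
  E π τ = (# (ι (π ≟ₚ τ)) ℚ.- δ τ) ℚ.+ (# (path τ (end π)) ℚ.- # (path τ (beg π)))

  -- Both counts run over one period of the same length, so E π is a multiple of a difference of two
  -- feasible points when π avoids.
  E≡cyc-cyc : ∀ π τ → E π τ ≡ # (cyc π τ) ℚ.- # (cyc (top (beg π)) τ)
  E≡cyc-cyc π τ = begin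
    (i ℚ.- d) ℚ.+ (q ℚ.- p)
      ≡⟨ solve 5 (λ i d q p b → (i :- d) :+ (q :- p) := (b :+ (i :+ q)) :- (b :+ (p :+ d))) refl
           i d q p b ⟩
    (b ℚ.+ (i ℚ.+ q)) ℚ.- (b ℚ.+ (p ℚ.+ d))       ≡⟨ cong (ℚ._- (b ℚ.+ (p ℚ.+ d))) balance ⟨
    (a ℚ.+ (p ℚ.+ d)) ℚ.- (b ℚ.+ (p ℚ.+ d))       ≡⟨ solve 3 (λ a b x → (a :+ x) :- (b :+ x) := a :- b) refl a b (p ℚ.+ d) ⟩
    a ℚ.- b                                       ∎
    where
    open ≡-Reasoning
    open +-*-Solver
    a b p q i d : ℚ
    a = # (cyc π τ)
    b = # (cyc (top (beg π)) τ)
    p = # (path τ (beg π))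
    q = # (path τ (end π))
    i = # (ι (π ≟ₚ τ))
    d = δ τ
    #-++ : ∀ x y z → # (x + (y + z)) ≡ # x ℚ.+ (# y ℚ.+ # z)
    #-++ x y z = trans (#-+ x (y + z)) (cong (# x ℚ.+_) (#-+ y z))
    balance : a ℚ.+ (p ℚ.+ d) ≡ b ℚ.+ (i ℚ.+ q)
    balance = trans (sym (#-++ (cyc π τ) (path τ (beg π)) (ι (std idSeq k ≟ₚ τ))))
      (trans (cong # (cyc-difference π τ))
        (#-++ (cyc (top (beg π)) τ) (ι (π ≟ₚ τ)) (path τ (end π))))

  -- For such π the two periodic permutations coincide.
  E-onTree : ∀ π τ → π ≡ top (beg π) → E π τ ≡ 0ℚ
  E-onTree π τ eq = trans (E≡cyc-cyc π τ)
    (trans (cong (λ ρ → # (cyc π τ) ℚ.- # (cyc ρ τ)) (sym eq)) (ℚ.+-inverseʳ (# (cyc π τ))))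

  -- The paths and the identity loop consist of edges ρ ⊕ 1 only, so they miss τ.
  E-offTree : ∀ π τ → τ ≢ top (beg τ) → E π τ ≡ # (ι (π ≟ₚ τ))
  E-offTree π τ τ≢ = trans (cong₂ ℚ._+_
      (cong (λ x → # (ι (π ≟ₚ τ)) ℚ.- # x) (ι-no (std idSeq k ≟ₚ τ) λ { refl → τ≢ (sym top-beg-id) }))
      (cong₂ (λ x y → # x ℚ.- # y) (path-off-tree τ (end π) τ≢) (path-off-tree τ (beg π) τ≢)))
    (trans (ℚ.+-identityʳ _) (ℚ.+-identityʳ _))

  module FundamentalCycles {d : ℕ} (edge : Fin d → Perm k)
    (edge-offTree : ∀ j → edge j ≢ top (beg (edge j)))
    (edge-avoids : ∀ j → edge j avoids ↘ n)
    (edge-injective : ∀ i j → edge i ≡ edge j → i ≡ j)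
    (edge-surjective : ∀ {π} → π ≢ top (beg π) → π avoids ↘ n → ∃[ j ] π ≡ edge j)
    where

-- The linear equations of the feasible region

    module _ (τ : Perm k) where

      -- The expansion x = [id] + Σ x_π E π at coordinate τ reads `L x ≡ δ τ`. Only non-tree edges
      -- are summed, as E vanishes on the others.
      L : (Perm k → ℚ) → ℚ
      L x = x τ ℚ.- sum (λ j → x (edge j) ℚ.* E (edge j) τ)

      L-cong : ∀ {x y} → (∀ π → x π ≡ y π) → L x ≡ L y
      L-cong eq = cong₂ ℚ._-_ (eq τ) (sum-cong-≗ λ j → cong (ℚ._* E (edge j) τ) (eq (edge j)))

      L-+ : ∀ x y → L (λ π → x π ℚ.+ y π) ≡ L x ℚ.+ L y
      L-+ x y = trans (cong (λ z → (x τ ℚ.+ y τ) ℚ.- z) (trans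
          (sum-cong-≗ λ j → ℚ.*-distribʳ-+ (E (edge j) τ) (x (edge j)) (y (edge j)))
          (∑-distrib-+ (λ j → x (edge j) ℚ.* E (edge j) τ) (λ j → y (edge j) ℚ.* E (edge j) τ))))
        (regroup (x τ) (y τ) _ _)
        where
        open +-*-Solver
        regroup : ∀ a b s t → (a ℚ.+ b) ℚ.- (s ℚ.+ t) ≡ (a ℚ.- s) ℚ.+ (b ℚ.- t)
        regroup = solve 4 (λ a b s t → (a :+ b) :- (s :+ t) := (a :- s) :+ (b :- t)) refl

      L-* : ∀ c x → L (λ π → c ℚ.* x π) ≡ c ℚ.* L x
      L-* c x = trans (cong (λ z → c ℚ.* x τ ℚ.- z) (trans
          (sum-cong-≗ λ j → ℚ.*-assoc c (x (edge j)) (E (edge j) τ))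
          (sym (*-distribˡ-sum c (λ j → x (edge j) ℚ.* E (edge j) τ)))))
        (solve 3 (λ c a s → c :* a :- c :* s := c :* (a :- s)) refl c (x τ) _)
        where
        open +-*-Solver

      L-0 : L (λ _ → 0ℚ) ≡ 0ℚ
      L-0 = trans (L-* 0ℚ (λ _ → 0ℚ)) (ℚ.*-zeroˡ (L λ _ → 0ℚ))

      L-neg : ∀ (s : ℚ) → ℚ.- 1ℚ ℚ.* s ≡ ℚ.- s
      L-neg = solve 1 (λ s → con (ℚ.- 1ℚ) :* s := :- s) refl
        where
        open +-*-Solver

      null-L : (x : Perm k → ℕ → ℚ) → (∀ π → Null (x π)) → Null (λ t → L (λ π → x π t))
      null-L x null = null-+ (null τ) (null-cong (λ t → L-neg _) (null-* (const-bounded (ℚ.- 1ℚ))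
        (null-sum (λ j t → x (edge j) t ℚ.* E (edge j) τ) λ j →
          null-cong (λ t → ℚ.*-comm (E (edge j) τ) _) (null-* (const-bounded (E (edge j) τ)) (null (edge j))))))

      converges-L : (q r : Perm k → ℕ → ℚ) → (∀ π → Converges (q π) (r π)) →
        Converges (λ i → L (λ π → q π i)) (λ t → L (λ π → r π t))
      converges-L q r conv = converges-+ {q τ} {r τ} {λ i → ℚ.- Q i} {λ t → ℚ.- R t} (conv τ)
        (converges-neg {Q} {R} (converges-sum (λ j i → q (edge j) i ℚ.* E (edge j) τ) (λ j t → r (edge j) t ℚ.* E (edge j) τ)
            λ j → converges-* (E (edge j) τ) {q (edge j)} {r (edge j)} (conv (edge j))))
        where
        Q R : ℕ → ℚ
        Q i = sum (λ j → q (edge j) i ℚ.* E (edge j) τ)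
        R t = sum (λ j → r (edge j) t ℚ.* E (edge j) τ)

      -- If w is of the form ρ ⊕ 1, both sides are 0; otherwise w is `edge j` for exactly one j.
      ∑-edges : ∀ w → w avoids ↘ n → sum (λ j → # (ι (w ≟ₚ edge j)) ℚ.* E (edge j) τ) ≡ E w τ
      ∑-edges w av = cases (w ≟ₚ top (beg w))
        where
        f : Fin d → ℚ
        f j = # (ι (w ≟ₚ edge j)) ℚ.* E (edge j) τ
        f-≢ : ∀ j → w ≢ edge j → f j ≡ 0ℚ
        f-≢ j w≢ = #0* (E (edge j) τ) (ι-no (w ≟ₚ edge j) w≢)
        f-≡ : ∀ j → w ≡ edge j → f j ≡ E w τ
        f-≡ j w≡ = trans (#1* (E (edge j) τ) (ι-yes (w ≟ₚ edge j) w≡)) (cong (λ v → E v τ) (sym w≡))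
        cases : Dec (w ≡ top (beg w)) → sum f ≡ E w τ
        cases (yes w≡) = trans (sum-zero f λ j → f-≢ j λ w≡e →
          edge-offTree j (subst (λ v → v ≡ top (beg v)) w≡e w≡)) (sym (E-onTree w τ w≡))
        cases (no w≢) = let (j₀ , w≡) = edge-surjective w≢ av in
          trans (sum-unique f j₀ λ j j≢ → f-≢ j λ w≡e → j≢ (edge-injective j j₀ (trans (sym w≡e) w≡)))
            (f-≡ j₀ w≡)

      -- The multiplicity of τ in the path from the vertex that the walk of `s` visits at time i.
      potential : Seq → ℕ → ℚ
      potential s i = # (path τ (std (shift i s) K))

      -- Subtracting E w from [w] leaves [id] and the drop of the potential from beg w to end w. The
      -- end of one window is the beginning of the next, so these drops telescope in `L-windows`.
      L-window : ∀ s i → std (shift i s) k avoids ↘ n →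
        L (λ π → # (occ π s i)) ≡ δ τ ℚ.+ (potential s i ℚ.- potential s (suc i))
      L-window s i av = trans (cong (λ z → # (ι (w ≟ₚ τ)) ℚ.- z) (∑-edges w av))
        (trans (solve 4 (λ i d q p → i :- ((i :- d) :+ (q :- p)) := d :+ (p :- q)) refl
          (# (ι (w ≟ₚ τ))) (δ τ) (# (path τ (end w))) (# (path τ (beg w))))
        (cong₂ (λ ρ ρ′ → δ τ ℚ.+ (# (path τ ρ) ℚ.- # (path τ ρ′))) (beg-std (shift i s))
          (trans (end-std (shift i s)) (std-cong (shift 1 (shift i s)) (shift (suc i) s)
            (~-offset (shift 1 (shift i s)) (shift (suc i) s) 0 λ a _ → cong (val s) (+-suc i a))))))
        where
        open +-*-Solver
        w : Perm k
        w = std (shift i s) k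

      L-windows : ∀ s M → (∀ i → i < M → std (shift i s) k avoids ↘ n) →
        L (λ π → # (∑< M (occ π s))) ≡ # M ℚ.* δ τ ℚ.+ (potential s 0 ℚ.- potential s M)
      L-windows s zero av = trans L-0 (sym (solve 2 (λ d p → con 0ℚ :* d :+ (p :- p) := con 0ℚ) refl (δ τ) (potential s 0)))
        where
        open +-*-Solver
      L-windows s (suc M) av = begin
        L (λ π → # (∑< M (occ π s) + occ π s M))
          ≡⟨ L-cong (λ π → #-+ (∑< M (occ π s)) (occ π s M)) ⟩
        L (λ π → # (∑< M (occ π s)) ℚ.+ # (occ π s M))
          ≡⟨ L-+ (λ π → # (∑< M (occ π s))) (λ π → # (occ π s M)) ⟩
        L (λ π → # (∑< M (occ π s))) ℚ.+ L (λ π → # (occ π s M))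
          ≡⟨ cong₂ ℚ._+_ (L-windows s M λ i i<M → av i (m<n⇒m<1+n i<M)) (L-window s M (av M (n<1+n M))) ⟩
        (# M ℚ.* δ τ ℚ.+ (potential s 0 ℚ.- potential s M)) ℚ.+ (δ τ ℚ.+ (potential s M ℚ.- potential s (suc M)))
          ≡⟨ solve 5 (λ m d a b c → (m :* d :+ (a :- b)) :+ (d :+ (b :- c)) := (con 1ℚ :+ m) :* d :+ (a :- c)) refl
               (# M) (δ τ) (potential s 0) (potential s M) (potential s (suc M)) ⟩
        # (suc M) ℚ.* δ τ ℚ.+ (potential s 0 ℚ.- potential s (suc M)) ∎
        where
        open ≡-Reasoning
        open +-*-Solver

      -- The error is at most K for each of the two potentials that survive telescoping, and at most
      -- K for the final positions at which no window starts.
      L-perm : ∀ {m} .{{_ : NonZero m}} (σ : Perm m) → σ avoids ↘ n →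
        ℚ.∣ L (λ π → c-occ~ π σ) ℚ.- δ τ ∣ ℚ.≤ u m ℚ.* # (K + K + K)
      L-perm {m} σ av = subst (λ x → ℚ.∣ x ∣ ℚ.≤ u m ℚ.* # (K + K + K)) (sym difference)
        (subst (ℚ._≤ u m ℚ.* # (K + K + K)) (sym (∣u*∣ m _)) (u*-mono-≤ m
          (subst (ℚ.∣ (a ℚ.- b) ℚ.- # r ℚ.* δ τ ∣ ℚ.≤_)
            (trans (cong (ℚ._+ # K) (sym (#-+ K K))) (sym (#-+ (K + K) K)))
            (∣+∣-≤ {a ℚ.- b} {ℚ.- (# r ℚ.* δ τ)}
              (∣+∣-≤ {a} {ℚ.- b} (∣path∣ 0) (subst (ℚ._≤ # K) (sym (ℚ.∣-p∣≡∣p∣ b)) (∣path∣ M)))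
              (subst (ℚ._≤ # K) (sym (trans (ℚ.∣-p∣≡∣p∣ (# r ℚ.* δ τ)) (trans (cong ℚ.∣_∣ (sym (#-* r ι₀))) (∣#∣ (r * ι₀)))))
                (#-mono-≤ (≤-trans (*-mono-≤ r≤K (ι≤1 (std idSeq k ≟ₚ τ))) (≤-reflexive (*-identityʳ K)))))))))
        where
        s : Seq
        s = ext σ
        M r ι₀ : ℕ
        M = m ∸ K
        r = m ∸ M
        ι₀ = ι (std idSeq k ≟ₚ τ)
        a b : ℚ
        a = potential s 0
        b = potential s M
        ∣path∣ : ∀ i → ℚ.∣ potential s i ∣ ℚ.≤ # K
        ∣path∣ i = subst (ℚ._≤ # K) (sym (∣#∣ (path τ (std (shift i s) K)))) (#-mono-≤ (path≤K τ (std (shift i s) K)))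
        r≤K : r ≤ K
        r≤K = m∸[m∸n]≤n m K
        window : ∀ i → i < M → std (shift i s) k avoids ↘ n
        window i i<M = window-avoids {σ = σ} {i} {k} (window-fits i<M) av
        #m : # m ≡ # M ℚ.+ # r
        #m = trans (cong # (sym (m+[n∸m]≡n (m∸n≤m m K)))) (#-+ M r)
        difference : L (λ π → c-occ~ π σ) ℚ.- δ τ ≡ u m ℚ.* ((a ℚ.- b) ℚ.- # r ℚ.* δ τ)
        difference = begin
          L (λ π → c-occ~ π σ) ℚ.- δ τ
            ≡⟨ cong (ℚ._- δ τ) (trans (L-cong λ π → trans (/≡#*u (c-occ π σ) m)
                 (trans (ℚ.*-comm _ (u m)) (cong (λ c → u m ℚ.* # c) (c-occ≡∑ π σ)))) (L-* (u m) _)) ⟩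
          u m ℚ.* L (λ π → # (∑< M (occ π s))) ℚ.- δ τ
            ≡⟨ cong₂ (λ x y → u m ℚ.* x ℚ.- y) (L-windows s M window)
                 (sym (trans (cong (ℚ._* δ τ) (#*u≡1 m)) (ℚ.*-identityˡ (δ τ)))) ⟩
          u m ℚ.* (# M ℚ.* δ τ ℚ.+ (a ℚ.- b)) ℚ.- (# m ℚ.* u m) ℚ.* δ τ
            ≡⟨ cong (λ x → u m ℚ.* (# M ℚ.* δ τ ℚ.+ (a ℚ.- b)) ℚ.- (x ℚ.* u m) ℚ.* δ τ) #m ⟩
          u m ℚ.* (# M ℚ.* δ τ ℚ.+ (a ℚ.- b)) ℚ.- ((# M ℚ.+ # r) ℚ.* u m) ℚ.* δ τ
            ≡⟨ solve 5 (λ u m d x r → u :* (m :* d :+ x) :- ((m :+ r) :* u) :* d := u :* (x :- r :* d)) refl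
                 (u m) (# M) (δ τ) (a ℚ.- b) (# r) ⟩
          u m ℚ.* ((a ℚ.- b) ℚ.- # r ℚ.* δ τ) ∎
          where
          open ≡-Reasoning
          open +-*-Solver

      region-equation : ∀ v → FeasibleRegion n k v → Null (λ t → L (λ π → seq (v π) t) ℚ.- δ τ)
      region-equation v (_ , σ , size→∞ , lim) =
        converges-unique {λ i → L (λ π → q π i)} {λ t → L (λ π → seq (v π) t)} (δ τ)
          (converges-L q (λ π → seq (v π)) λ π → ⟶⇒converges (q π) (v π) (lim π))
          λ ε 0<ε → let (B , small) = u*#-small (K + K + K) ε 0<ε
                        (N , large) = size→∞ B
                    in N , λ i N≤i → ℚ.≤-trans
                      (L-perm {{nonEmpty (σ i)}} (perm (σ i)) (avoiding (σ i)))
                      (small (size (σ i)) {{nonEmpty (σ i)}} (large i N≤i))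
        where
        q : Perm k → ℕ → ℚ
        q π i = c-occ~ {{nonEmpty (σ i)}} π (perm (σ i))

      -- The right-hand side separates the errors of the points from the sum of the weights, as each
      -- is controlled on its own.
      L-linComb : ∀ {r} (c : Fin r → ℚ) (p : Fin r → Perm k → ℚ) →
        L (λ π → sum (λ i → c i ℚ.* p i π)) ≡ sum (λ i → c i ℚ.* (L (p i) ℚ.- δ τ)) ℚ.+ sum c ℚ.* δ τ
      L-linComb {zero} c p = trans L-0 (solve 1 (λ d → con 0ℚ := con 0ℚ :+ con 0ℚ :* d) refl (δ τ))
        where
        open +-*-Solver
      L-linComb {suc r} c p = begin
        L (λ π → c zero ℚ.* p zero π ℚ.+ sum (λ i → c (suc i) ℚ.* p (suc i) π))
          ≡⟨ L-+ (λ π → c zero ℚ.* p zero π) (λ π → sum (λ i → c (suc i) ℚ.* p (suc i) π)) ⟩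
        L (λ π → c zero ℚ.* p zero π) ℚ.+ L (λ π → sum (λ i → c (suc i) ℚ.* p (suc i) π))
          ≡⟨ cong₂ ℚ._+_ (L-* (c zero) (p zero)) (L-linComb (c ∘ suc) (p ∘ suc)) ⟩
        c zero ℚ.* L (p zero) ℚ.+ (S ℚ.+ sum (c ∘ suc) ℚ.* δ τ)
          ≡⟨ solve 5 (λ c l s t d → c :* l :+ (s :+ t :* d) := (c :* (l :- d) :+ s) :+ (c :+ t) :* d) refl
               (c zero) (L (p zero)) S (sum (c ∘ suc)) (δ τ) ⟩
        (c zero ℚ.* (L (p zero) ℚ.- δ τ) ℚ.+ S) ℚ.+ (c zero ℚ.+ sum (c ∘ suc)) ℚ.* δ τ ∎
        where
        open ≡-Reasoning
        open +-*-Solver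
        S : ℚ
        S = sum (λ i → c (suc i) ℚ.* (L (p (suc i)) ℚ.- δ τ))

      -- At the level of rational approximations three errors remain, all null: that of x against
      -- its affine combination, those of the points in their equations, and that of the sum of the
      -- weights against 1.
      hull-equation : ∀ x → AffineHull (FeasibleRegion n k) x → Null (λ t → L (λ π → seq (x π) t) ℚ.- δ τ)
      hull-equation x (r , p , c , Ap , ∑c , x≈) = null-cong (λ t → sym (rewriting t))
        (null-+ (null-L (λ π t → seq (x π) t ℚ.- seq (linComb c p π) t) x≈)
        (null-+ (null-sum _ λ i → null-* (real-bounded (c i)) (region-equation (p i) (Ap i)))
          (null-* (const-bounded (δ τ)) ∑c)))
        where
        X Y : ℕ → Perm k → ℚ
        X t π = seq (x π) t
        Y t π = seq (linComb c p π) t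
        rewriting : ∀ t → L (λ π → seq (x π) t) ℚ.- δ τ ≡
          L (λ π → seq (x π) t ℚ.- seq (linComb c p π) t) ℚ.+
          (sum (λ i → seq (c i) t ℚ.* (L (λ π → seq (p i π) t) ℚ.- δ τ)) ℚ.+
           δ τ ℚ.* (seq (sumℝ c) t ℚ.- 1ℚ))
        rewriting t = begin
          L (λ π → seq (x π) t) ℚ.- δ τ
            ≡⟨ cong (ℚ._- δ τ) (L-cong λ π → solve 2 (λ a b → a := (a :- b) :+ b) refl
                 (seq (x π) t) (seq (linComb c p π) t)) ⟩
          L (λ π → (seq (x π) t ℚ.- seq (linComb c p π) t) ℚ.+ seq (linComb c p π) t) ℚ.- δ τ
            ≡⟨ cong (ℚ._- δ τ) (trans (L-+ (λ π → X t π ℚ.- Y t π) (Y t)) (cong (D ℚ.+_) (trans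
                 (L-cong λ π → seq-sumℝ (λ i → c i *ℝ p i π) t)
                 (L-linComb (λ i → seq (c i) t) (λ i π → seq (p i π) t))))) ⟩
          (D ℚ.+ (S ℚ.+ sum (λ i → seq (c i) t) ℚ.* δ τ)) ℚ.- δ τ
            ≡⟨ cong (λ y → (D ℚ.+ (S ℚ.+ y ℚ.* δ τ)) ℚ.- δ τ) (sym (seq-sumℝ c t)) ⟩
          (D ℚ.+ (S ℚ.+ seq (sumℝ c) t ℚ.* δ τ)) ℚ.- δ τ
            ≡⟨ solve 4 (λ a s y d → (a :+ (s :+ y :* d)) :- d := a :+ (s :+ d :* (y :- con 1ℚ))) refl
                 D S (seq (sumℝ c) t) (δ τ) ⟩
          D ℚ.+ (S ℚ.+ δ τ ℚ.* (seq (sumℝ c) t ℚ.- 1ℚ)) ∎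
          where
          open ≡-Reasoning
          open +-*-Solver
          D S : ℚ
          D = L (λ π → seq (x π) t ℚ.- seq (linComb c p π) t)
          S = sum (λ i → seq (c i) t ℚ.* (L (λ π → seq (p i π) t) ℚ.- δ τ))

-- The dimension

    origin : Point k
    origin τ = fromℚ (δ τ)

    e : Fin d → Point k
    e j τ = fromℚ (E (edge j) τ)

    seq-linComb-e : ∀ (c : Fin d → ℝ) τ t →
      seq (linComb c e τ) t ≡ sum (λ j → seq (c j) t ℚ.* E (edge j) τ)
    seq-linComb-e c τ t = seq-sumℝ (λ j → c j *ℝ e j τ) t

    -- By `E-offTree`, the coordinate at `edge i` of a combination is its i-th coefficient.
    e-independent : LinearlyIndependent e
    e-independent c ≈0 i = null-cong
      (λ t → cong (ℚ._- 0ℚ) (trans (seq-linComb-e c (edge i) t) (coordinate t))) (≈0 (edge i))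
      where
      coordinate : ∀ t → sum (λ j → seq (c j) t ℚ.* E (edge j) (edge i)) ≡ seq (c i) t
      coordinate t = trans
        (sum-unique _ i λ j j≢i → trans (cong (seq (c j) t ℚ.*_) (trans (E-offTree (edge j) (edge i) (edge-offTree i))
          (cong # (ι-no (edge j ≟ₚ edge i) (j≢i ∘ edge-injective j i))))) (ℚ.*-zeroʳ (seq (c j) t)))
        (trans (cong (seq (c i) t ℚ.*_) (trans (E-offTree (edge i) (edge i) (edge-offTree i))
          (cong # (ι-yes (edge i ≟ₚ edge i) refl)))) (ℚ.*-identityʳ _))

    -- The coefficients are the coordinates of x at the non-tree edges, and the claim is then
    -- `hull-equation` rearranged.
    hull⇒combination : ∀ x → AffineHull (FeasibleRegion n k) x →
      ∃[ c ] x ≈ₚ (λ τ → origin τ +ℝ linComb c e τ)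
    hull⇒combination x x∈ = (λ j → x (edge j)) , λ τ → null-cong
      (λ t → trans (solve 3 (λ a s d → (a :- s) :- d := a :- (d :+ s)) refl (seq (x τ) t)
          (sum (λ j → seq (x (edge j)) t ℚ.* E (edge j) τ)) (δ τ))
        (cong (λ s → seq (x τ) t ℚ.- (δ τ ℚ.+ s)) (sym (seq-linComb-e (λ j → x (edge j)) τ t))))
      (hull-equation τ x x∈)
      where
      open +-*-Solver

    origin-feasible : FeasibleRegion n k (frequency idSeq 1)
    origin-feasible = frequency-feasible idSeq 1
      (λ i → ~-offset (shift (1 + i) idSeq) (shift i idSeq) 1 λ _ _ → refl) λ l → id-avoids l 2≤n

    origin≈ : origin ≈ₚ frequency idSeq 1
    origin≈ τ = ≡⇒≈ℝ {origin τ} {frequency idSeq 1 τ} λ _ → sym (trans (/≡#*u (occ τ idSeq 0) 1)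
      (trans (ℚ.*-identityʳ _) (cong (λ w → # (ι (w ≟ₚ τ)))
        (std-cong (shift 0 idSeq) idSeq (~-refl idSeq)))))

    cycle : Perm k → Point k
    cycle π = frequency (periodic π) (k + k)

    cycle-feasible : ∀ {π} → π avoids ↘ n → FeasibleRegion n k (cycle π)
    cycle-feasible {π} av = frequency-feasible (periodic π) (k + k) (periodic-shift π) (periodic-avoids π 2≤n av)

    combination⇒hull : ∀ x → ∃[ c ] x ≈ₚ (λ τ → origin τ +ℝ linComb c e τ) →
      AffineHull (FeasibleRegion n k) x
    combination⇒hull x (c , x≈) = hull-resp (FeasibleRegion n k) {x} {y}
      (λ τ → ≈ℝ-trans (x τ) (origin τ +ℝ linComb c e τ) (y τ) (x≈ τ)
        (null-cong (λ t → trans (shared (δ τ) (seq (frequency idSeq 1 τ) t) (seq (linComb c e τ) t))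
            (cong (λ l → (δ τ ℚ.+ seq (linComb c e τ) t) ℚ.- (seq (frequency idSeq 1 τ) t ℚ.+ l)) (sums τ t)))
          (origin≈ τ)))
      (hull-differences (FeasibleRegion n k) {d} {frequency idSeq 1} c′
        (λ j → cycle (edge j)) (λ j → cycle (top (beg (edge j))))
        origin-feasible (λ j → cycle-feasible {edge j} (edge-avoids j))
        λ j → cycle-feasible {top (beg (edge j))}
          (top-avoids {ρ = beg (edge j)} 2≤n (beg-avoids {π = edge j} (edge-avoids j))))
      where
      open +-*-Solver
      P : ℕ
      P = k + k
      -- The factor P undoes the division by the period in `frequency`, since E is a difference of
      -- counts.
      c′ : Fin d → ℝ
      c′ j = c j *ℝ fromℚ (# P)
      y : Point k
      y τ = frequency idSeq 1 τ +ℝ sumℝ (λ j → c′ j *ℝ (cycle (edge j) τ -ℝ cycle (top (beg (edge j))) τ))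
      shared : ∀ o f l → o ℚ.- f ≡ (o ℚ.+ l) ℚ.- (f ℚ.+ l)
      shared = solve 3 (λ o f l → o :- f := (o :+ l) :- (f :+ l)) refl
      rescale : ∀ j τ q → q ℚ.* E (edge j) τ ≡
        (q ℚ.* # P) ℚ.* ((+ cyc (edge j) τ ℚ./ P) ℚ.- (+ cyc (top (beg (edge j))) τ ℚ./ P))
      rescale j τ q = sym (begin
        (q ℚ.* # P) ℚ.* ((+ a ℚ./ P) ℚ.- (+ b ℚ./ P))
          ≡⟨ cong₂ (λ x y → (q ℚ.* # P) ℚ.* (x ℚ.- y)) (/≡#*u a P) (/≡#*u b P) ⟩
        (q ℚ.* # P) ℚ.* (# a ℚ.* u P ℚ.- # b ℚ.* u P)
          ≡⟨ solve 5 (λ q p a b u → (q :* p) :* (a :* u :- b :* u) := (p :* u) :* (q :* (a :- b))) refl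
               q (# P) (# a) (# b) (u P) ⟩
        (# P ℚ.* u P) ℚ.* (q ℚ.* (# a ℚ.- # b))
          ≡⟨ cong (ℚ._* (q ℚ.* (# a ℚ.- # b))) (#*u≡1 P) ⟩
        1ℚ ℚ.* (q ℚ.* (# a ℚ.- # b))
          ≡⟨ ℚ.*-identityˡ _ ⟩
        q ℚ.* (# a ℚ.- # b)
          ≡⟨ cong (q ℚ.*_) (E≡cyc-cyc (edge j) τ) ⟨
        q ℚ.* E (edge j) τ ∎)
        where
        open ≡-Reasoning
        a b : ℕ
        a = cyc (edge j) τ
        b = cyc (top (beg (edge j))) τ
      sums : ∀ τ t → seq (linComb c e τ) t ≡
        seq (sumℝ (λ j → c′ j *ℝ (cycle (edge j) τ -ℝ cycle (top (beg (edge j))) τ))) t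
      sums τ t = trans (seq-linComb-e c τ t) (trans (sum-cong-≗ λ j → rescale j τ (seq (c j) t))
        (sym (seq-sumℝ (λ j → c′ j *ℝ (cycle (edge j) τ -ℝ cycle (top (beg (edge j))) τ)) t)))

    dimension : HasDimension (FeasibleRegion n k) d
    dimension = origin , e , e-independent , λ x → mk⇔ (hull⇒combination x) (combination⇒hull x)

  dimension : HasDimension (FeasibleRegion n k) (length (offTree {K} n))
  dimension = FundamentalCycles.dimension (List.lookup (offTree n))
    (λ j → proj₁ (offTree⁻ {n = n} (∈-lookup j)))
    (λ j → proj₂ (offTree⁻ {n = n} (∈-lookup j)))
    (lookup-injective (offTree-unique n))
    λ π≢ av → let π∈ = ∈-offTree {n = n} π≢ av in index π∈ , lookup-index π∈

-- The dimension as a difference of cardinalities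

+-difference : ∀ a {b c} → a + b ≡ c → + b ≡ + c - + a
+-difference a {b} refl = sym (trans (cong (_- + a) (ℤ.pos-+ a b))
  (solve 2 (λ a b → (a :+ b) :- a := b) refl (+ a) (+ b)))
  where
  open ℤ.+-*-Solver

mainTheorem8 : ∀ (n k : ℕ) → 2 ≤ n → 1 ≤ k →
    ∃[ d ] HasDimension (FeasibleRegion n k) d ×
    + d ≡ + ∣Av∣ k n - + ∣Av∣ (k ∸ 1) n
mainTheorem8 n (suc K) 2≤n _ = length (offTree {K} n) , dimension 2≤n , +-difference (∣Av∣ K n) (∣Av∣-split {K} n 2≤n)
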